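{- Let $m \geq 4$ be an integer with $m \equiv 0 \pmod 4$, and let $(\boldsymbol{x}_n)_{0 \leq n < 2^m}$ be a $(0,m,2)$-net in base $2$ such that $\boldsymbol{x}_0 = \boldsymbol{\gamma} = (\gamma^{(1)},\gamma^{(2)})$, where \[ \gamma^{(1)} = \frac{1}{2^2} + \frac{1}{2^4}+ \cdots + \frac{1}{2^{m/2}}, \qquad \gamma^{(2)} = \frac{1}{2^{m/2+2}} + \frac{1}{2^{m/2+4}} + \cdots + \frac{1}{2^m}. \] Put $N = 2^m$. Then for the interval $J_{\boldsymbol{\gamma}} = [0,\gamma^{(1)}) \times [0,\gamma^{(2)})$ one has \[ \frac{1}{N} \Delta (\boldsymbol{\gamma},(\boldsymbol{x}_n)_{0 \leq n < 2^m}) \leq -\frac{1}{4} \cdot \frac{1}{2^{m+2}}\, m, \] and consequently \[ D^{*}((\boldsymbol{x}_n)_{0 \leq n < N}) \geq \frac{1}{16 \log 2} \frac{\log N}{N}. \]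
   Context: For integers $b \geq 2$, $s \geq 1$, $0 \leq t \leq m$, a $(t,m,s)$-net in base $b$ is a set (family) of $b^m$ points $\boldsymbol{x}_0,\dots,\boldsymbol{x}_{b^m-1}$ in $[0,1)^s$ such that every interval of the form $\prod_{i=1}^s [a_i b^{ -d_i}, (a_i+1) b^{ -d_i})$ with $d_i \in \mathbb{N}_0$, $a_i \in \{0,\dots,b^{d_i}-1\}$ and volume $b^{ -m+t}$ contains exactly $b^t$ of the points. For a finite family of points $(\boldsymbol{x}_n)_{n}$ in $[0,1)^s$ and $\boldsymbol{y} = (y^{(1)},\dots,y^{(s)}) \in [0,1]^s$, the discrepancy function is $\Delta(\boldsymbol{y},(\boldsymbol{x}_n)_n) = \sum_{n} \big(\chi_{[\boldsymbol{0},\boldsymbol{y})}(\boldsymbol{x}_n) - y^{(1)}\cdots y^{(s)}\big)$, where $[\boldsymbol{0},\boldsymbol{y}) = [0,y^{(1)})\times\cdots\times[0,y^{(s)})$ and $\chi$ denotes the indicator function; the star-discrepancy of an $N$-point family is $D^*((\boldsymbol{x}_n)_n) = \sup_{\boldsymbol{y} \in [0,1)^s} \big| \frac{1}{N}\Delta(\boldsymbol{y},(\boldsymbol{x}_n)_n)\big|$. $\log$ denotes the natural logarithm. -}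

module Defs where

open import Data.Bool.Base using (if_then_else_)
open import Data.Fin.Base using (Fin; toℕ; fromℕ<)
open import Data.Integer.Base as ℤ using (+_; +[1+_]; -[1+_]; +0)
import Data.Integer.Properties as ℤₚ
open import Data.List.Base using (length; filter; allFin)
open import Data.Nat.Base as ℕ using (ℕ; zero; suc; NonZero; NonTrivial)
import Data.Nat.Properties as ℕₚ
open import Data.Nat.Tactic.RingSolver using (solve-∀)
open import Data.Product.Base using (_×_; _,_; ∃-syntax; Σ-syntax; proj₁; proj₂)
open import Data.Rational.Base as ℚ using (ℚ; mkℚ; 0ℚ; 1ℚ; ½; _/_)
import Data.Rational.Properties as ℚₚ
open import Data.Rational.Solver using (module +-*-Solver)
import Data.Rational.Unnormalised.Base as ℚᵘ
import Data.Rational.Unnormalised.Properties as ℚᵘₚ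
open import Data.Sum.Base using (inj₁; inj₂)
open import Data.Vec.Functional using (Vector; foldr; []; _∷_)
open import Relation.Binary.PropositionalEquality.Core using (_≡_; refl; sym; trans; cong; cong₂; subst; subst₂)
open import Relation.Nullary.Decidable.Core using (Dec; yes; no; does)
open import Relation.Nullary.Negation.Core using (¬_; contradiction)
open import Relation.Unary using (Pred; Decidable)
open import Level using (0ℓ)

private
  module S = +-*-Solver

pos : ∀ {p} → 0ℚ ℚ.< p → ℚ.Positive p
pos = ℚ.positive

pos⁻¹ : ∀ p → ℚ.Positive p → 0ℚ ℚ.< p
pos⁻¹ p h = ℚₚ.positive⁻¹ p {{h}}

0<p*q : ∀ {p q} → 0ℚ ℚ.< p → 0ℚ ℚ.< q → 0ℚ ℚ.< p ℚ.* q
0<p*q {p} {q} hp hq = pos⁻¹ _ (ℚₚ.pos*pos⇒pos p {{pos hp}} q {{pos hq}})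

0<½ : 0ℚ ℚ.< ½
0<½ = pos⁻¹ ½ _

½<1 : ½ ℚ.< 1ℚ
½<1 = ℚ.*<* (ℤ.+<+ (ℕ.s≤s (ℕ.s≤s ℕ.z≤n)))

½+½ : ∀ ε → ½ ℚ.* ε ℚ.+ ½ ℚ.* ε ≡ ε
½+½ = S.solve 1 (λ e → S.con ½ S.:* e S.:+ S.con ½ S.:* e S.:= e) refl

*-mono-<-nonNeg : ∀ {a A c C} → 0ℚ ℚ.≤ a → a ℚ.< A → 0ℚ ℚ.≤ c → c ℚ.< C → a ℚ.* c ℚ.< A ℚ.* C
*-mono-<-nonNeg {a} {A} {c} {C} 0≤a a<A 0≤c c<C = ℚₚ.≤-<-trans
  (ℚₚ.*-monoˡ-≤-nonNeg a {{ℚ.nonNegative 0≤a}} (ℚₚ.<⇒≤ c<C))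
  (ℚₚ.*-monoˡ-<-pos C {{pos (ℚₚ.≤-<-trans 0≤c c<C)}} a<A)

p≤∣p∣ : ∀ p → p ℚ.≤ ℚ.∣ p ∣
p≤∣p∣ p with ℚₚ.≤-total 0ℚ p
... | inj₁ 0≤p = ℚₚ.≤-reflexive (sym (ℚₚ.0≤p⇒∣p∣≡p 0≤p))
... | inj₂ p≤0 = ℚₚ.≤-trans p≤0 (ℚₚ.0≤∣p∣ p)

∣p∣<q : ∀ {p q} → p ℚ.< q → ℚ.- p ℚ.< q → ℚ.∣ p ∣ ℚ.< q
∣p∣<q {p} {q} h₁ h₂ with ℚₚ.∣p∣≡p∨∣p∣≡-p p
... | inj₁ e = subst (ℚ._< q) (sym e) h₁
... | inj₂ e = subst (ℚ._< q) (sym e) h₂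

∣p-q∣≡∣q-p∣ : ∀ p q → ℚ.∣ p ℚ.- q ∣ ≡ ℚ.∣ q ℚ.- p ∣
∣p-q∣≡∣q-p∣ p q = trans (sym (ℚₚ.∣-p∣≡∣p∣ (p ℚ.- q)))
  (cong ℚ.∣_∣ (S.solve 2 (λ p q → S.:- (p S.:- q) S.:= q S.:- p) refl p q))

∣∣p∣-∣q∣∣<r : ∀ {p q r} → ℚ.∣ p ℚ.- q ∣ ℚ.< r → ℚ.∣ ℚ.∣ p ∣ ℚ.- ℚ.∣ q ∣ ∣ ℚ.< r
∣∣p∣-∣q∣∣<r {p} {q} {r} h = ∣p∣<q
  (ℚₚ.≤-<-trans (one p q) h)
  (subst (ℚ._< r) (S.solve 2 (λ a b → b S.:- a S.:= S.:- (a S.:- b)) refl ℚ.∣ p ∣ ℚ.∣ q ∣)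
    (ℚₚ.≤-<-trans (one q p) (subst (ℚ._< r) (∣p-q∣≡∣q-p∣ p q) h)))
  where
  one : ∀ a b → ℚ.∣ a ∣ ℚ.- ℚ.∣ b ∣ ℚ.≤ ℚ.∣ a ℚ.- b ∣
  one a b = subst (ℚ.∣ a ∣ ℚ.- ℚ.∣ b ∣ ℚ.≤_)
    (S.solve 2 (λ x y → (x S.:+ y) S.:- y S.:= x) refl ℚ.∣ a ℚ.- b ∣ ℚ.∣ b ∣)
    (ℚₚ.+-monoˡ-≤ (ℚ.- ℚ.∣ b ∣)
      (subst (λ z → ℚ.∣ z ∣ ℚ.≤ ℚ.∣ a ℚ.- b ∣ ℚ.+ ℚ.∣ b ∣)
        (S.solve 2 (λ a b → (a S.:- b) S.:+ b S.:= a) refl a b)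
        (ℚₚ.∣p+q∣≤∣p∣+∣q∣ (a ℚ.- b) b)))

-- Reciprocal on ℚ, with the junk value 0 at 0.
invℚ : ℚ → ℚ
invℚ p with p ℚₚ.≟ 0ℚ
... | yes _  = 0ℚ
... | no p≢0 = (ℚ.1/ p) {{ℚ.≢-nonZero p≢0}}

invℚ-*ˡ : ∀ {p} → 0ℚ ℚ.< p → invℚ p ℚ.* p ≡ 1ℚ
invℚ-*ˡ {p} 0<p with p ℚₚ.≟ 0ℚ
... | yes p≡0 = contradiction (sym p≡0) (ℚₚ.<⇒≢ 0<p)
... | no p≢0  = ℚₚ.*-inverseˡ p {{ℚ.≢-nonZero p≢0}}

0<invℚ : ∀ {p} → 0ℚ ℚ.< p → 0ℚ ℚ.< invℚ p
0<invℚ {p} 0<p with p ℚₚ.≟ 0ℚ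
... | yes p≡0 = contradiction (sym p≡0) (ℚₚ.<⇒≢ 0<p)
... | no p≢0  = pos⁻¹ _ (ℚₚ.1/pos⇒pos p {{pos 0<p}})

invℚ-anti-< : ∀ {e a} → 0ℚ ℚ.< e → e ℚ.< a → invℚ a ℚ.< invℚ e
invℚ-anti-< {e} {a} 0<e e<a = subst₂ ℚ._<_
  (trans (ℚₚ.*-assoc A E e) (trans (cong (A ℚ.*_) (invℚ-*ˡ 0<e)) (ℚₚ.*-identityʳ A)))
  (trans (S.solve 3 (λ A E a → A S.:* E S.:* a S.:= E S.:* (A S.:* a)) refl A E a)
    (trans (cong (E ℚ.*_) (invℚ-*ˡ 0<a)) (ℚₚ.*-identityʳ E)))
  (ℚₚ.*-monoʳ-<-pos (A ℚ.* E) {{pos (0<p*q (0<invℚ 0<a) (0<invℚ 0<e))}} e<a)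
  where
  A = invℚ a
  E = invℚ e
  0<a = ℚₚ.<-trans 0<e e<a

invℚ-dist : ∀ {e a b δ} → 0ℚ ℚ.< e → e ℚ.< a → e ℚ.< b → ℚ.∣ a ℚ.- b ∣ ℚ.< δ ℚ.* (e ℚ.* e) →
            ℚ.∣ invℚ a ℚ.- invℚ b ∣ ℚ.< δ
invℚ-dist {e} {a} {b} {δ} 0<e e<a e<b h = subst₂ ℚ._<_ lhs rhs
  (*-mono-<-nonNeg (ℚₚ.<⇒≤ 0<AB)
    (*-mono-<-nonNeg (ℚₚ.<⇒≤ 0<A) (invℚ-anti-< 0<e e<a) (ℚₚ.<⇒≤ 0<B) (invℚ-anti-< 0<e e<b))
    (ℚₚ.0≤∣p∣ (a ℚ.- b)) h)
  where
  A = invℚ a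
  B = invℚ b
  E = invℚ e
  0<a = ℚₚ.<-trans 0<e e<a
  0<b = ℚₚ.<-trans 0<e e<b
  0<A = 0<invℚ 0<a
  0<B = 0<invℚ 0<b
  0<AB = 0<p*q 0<A 0<B
  step : A ℚ.* B ℚ.* (b ℚ.- a) ≡ A ℚ.- B
  step = trans
    (S.solve 4 (λ A B a b → A S.:* B S.:* (b S.:- a) S.:= A S.:* (B S.:* b) S.:- B S.:* (A S.:* a)) refl A B a b)
    (cong₂ ℚ._-_
      (trans (cong (A ℚ.*_) (invℚ-*ˡ 0<b)) (ℚₚ.*-identityʳ A))
      (trans (cong (B ℚ.*_) (invℚ-*ˡ 0<a)) (ℚₚ.*-identityʳ B)))
  lhs : A ℚ.* B ℚ.* ℚ.∣ a ℚ.- b ∣ ≡ ℚ.∣ A ℚ.- B ∣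
  lhs = trans (cong₂ ℚ._*_ (sym (ℚₚ.0≤p⇒∣p∣≡p (ℚₚ.<⇒≤ 0<AB))) (∣p-q∣≡∣q-p∣ a b))
    (trans (sym (ℚₚ.∣p*q∣≡∣p∣*∣q∣ (A ℚ.* B) (b ℚ.- a))) (cong ℚ.∣_∣ step))
  rhs : E ℚ.* E ℚ.* (δ ℚ.* (e ℚ.* e)) ≡ δ
  rhs = trans
    (S.solve 3 (λ E e d → E S.:* E S.:* (d S.:* (e S.:* e)) S.:= d S.:* ((E S.:* e) S.:* (E S.:* e))) refl E e δ)
    (trans (cong (λ z → δ ℚ.* (z ℚ.* z)) (invℚ-*ˡ 0<e)) (ℚₚ.*-identityʳ δ))

sumℚ : ℕ → (ℕ → ℚ) → ℚ
sumℚ zero    f = 0ℚ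
sumℚ (suc n) f = sumℚ n f ℚ.+ f n

IsCauchy : (ℕ → ℚ) → Set
IsCauchy f = ∀ ε → 0ℚ ℚ.< ε → ∃[ K ] (∀ m n → K ℕ.≤ m → K ℕ.≤ n → ℚ.∣ f m ℚ.- f n ∣ ℚ.< ε)

-- Equality of real numbers is _≃_, not _≡_.
record ℝ : Set where
  constructor mkℝ
  field
    seq    : ℕ → ℚ
    cauchy : IsCauchy seq

open ℝ public

infix 4 _≃_ _<_ _≤_

_≃_ : ℝ → ℝ → Set
x ≃ y = ∀ ε → 0ℚ ℚ.< ε → ∃[ K ] (∀ n → K ℕ.≤ n → ℚ.∣ seq x n ℚ.- seq y n ∣ ℚ.< ε)

record _<_ (x y : ℝ) : Set where
  constructor mk<
  field
    gap       : ℚ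
    gap>0     : 0ℚ ℚ.< gap
    from      : ℕ
    separated : ∀ n → from ℕ.≤ n → seq x n ℚ.+ gap ℚ.< seq y n

-- Equivalent to: for every ε > 0, eventually seq x n ≤ seq y n + ε.
_≤_ : ℝ → ℝ → Set
x ≤ y = ¬ (y < x)

fromℚ : ℚ → ℝ
fromℚ q = mkℝ (λ _ → q) λ ε 0<ε → 0 , λ _ _ _ _ →
  subst (ℚ._< ε) (sym (cong ℚ.∣_∣ (ℚₚ.+-inverseʳ q))) 0<ε

fromℕ : ℕ → ℝ
fromℕ n = fromℚ (+ n / 1)

0ℝ 1ℝ : ℝ
0ℝ = fromℚ 0ℚ
1ℝ = fromℚ 1ℚ

+-cauchy : ∀ f g → IsCauchy f → IsCauchy g → IsCauchy (λ n → f n ℚ.+ g n)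
+-cauchy f g cf cg ε 0<ε with cf (½ ℚ.* ε) (0<p*q 0<½ 0<ε) | cg (½ ℚ.* ε) (0<p*q 0<½ 0<ε)
... | K , hK | L , hL = K ℕ.⊔ L , λ m n p q →
    (ℚₚ.≤-<-trans
      (subst (λ z → ℚ.∣ z ∣ ℚ.≤ ℚ.∣ f m ℚ.- f n ∣ ℚ.+ ℚ.∣ g m ℚ.- g n ∣)
        (S.solve 4 (λ a b c d → (a S.:- b) S.:+ (c S.:- d) S.:= (a S.:+ c) S.:- (b S.:+ d)) refl (f m) (f n) (g m) (g n))
        (ℚₚ.∣p+q∣≤∣p∣+∣q∣ (f m ℚ.- f n) (g m ℚ.- g n)))
      (subst (ℚ.∣ f m ℚ.- f n ∣ ℚ.+ ℚ.∣ g m ℚ.- g n ∣ ℚ.<_) (½+½ ε)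
        (ℚₚ.+-mono-< (hK m n (ℕₚ.m⊔n≤o⇒m≤o K L p) (ℕₚ.m⊔n≤o⇒m≤o K L q))
                     (hL m n (ℕₚ.m⊔n≤o⇒n≤o K L p) (ℕₚ.m⊔n≤o⇒n≤o K L q)))))

neg-cauchy : ∀ f → IsCauchy f → IsCauchy (λ n → ℚ.- f n)
neg-cauchy f cf ε 0<ε with cf ε 0<ε
... | K , hK = K , λ m n p q → subst (ℚ._< ε)
  (trans (∣p-q∣≡∣q-p∣ (f m) (f n))
    (cong ℚ.∣_∣ (S.solve 2 (λ a b → b S.:- a S.:= (S.:- a) S.:- (S.:- b)) refl (f m) (f n))))
  (hK m n p q)

abs-cauchy : ∀ f → IsCauchy f → IsCauchy (λ n → ℚ.∣ f n ∣)
abs-cauchy f cf ε 0<ε with cf ε 0<ε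
... | K , hK = K , λ m n p q → ∣∣p∣-∣q∣∣<r {f m} {f n} (hK m n p q)

cauchy-bound : ∀ f → IsCauchy f → ∃[ B ] (0ℚ ℚ.< B × ∃[ K ] (∀ n → K ℕ.≤ n → ℚ.∣ f n ∣ ℚ.< B))
cauchy-bound f cf with cf 1ℚ (pos⁻¹ 1ℚ _)
... | K , hK = B , ℚₚ.≤-<-trans (ℚₚ.0≤∣p∣ (f K)) (bnd K ℕₚ.≤-refl) , K , bnd
  where
  B = 1ℚ ℚ.+ ℚ.∣ f K ∣
  bnd : ∀ n → K ℕ.≤ n → ℚ.∣ f n ∣ ℚ.< B
  bnd n p = ℚₚ.≤-<-trans
    (subst (λ z → ℚ.∣ z ∣ ℚ.≤ ℚ.∣ f n ℚ.- f K ∣ ℚ.+ ℚ.∣ f K ∣)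
      (S.solve 2 (λ a b → (a S.:- b) S.:+ b S.:= a) refl (f n) (f K))
      (ℚₚ.∣p+q∣≤∣p∣+∣q∣ (f n ℚ.- f K) (f K)))
    (ℚₚ.+-monoˡ-< ℚ.∣ f K ∣ (hK n K p ℕₚ.≤-refl))

*-invℚ-cancel : ∀ C e → 0ℚ ℚ.< C → C ℚ.* (e ℚ.* invℚ C) ≡ e
*-invℚ-cancel C e 0<C = trans
  (S.solve 3 (λ C e I → C S.:* (e S.:* I) S.:= e S.:* (I S.:* C)) refl C e (invℚ C))
  (trans (cong (e ℚ.*_) (invℚ-*ˡ 0<C)) (ℚₚ.*-identityʳ e))

*-dist : ∀ {A B} a b c d η → 0ℚ ℚ.< A → 0ℚ ℚ.< B → ℚ.∣ a ∣ ℚ.< A → ℚ.∣ d ∣ ℚ.< B →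
         ℚ.∣ a ℚ.- b ∣ ℚ.< η ℚ.* invℚ B → ℚ.∣ c ℚ.- d ∣ ℚ.< η ℚ.* invℚ A →
         ℚ.∣ a ℚ.* c ℚ.- b ℚ.* d ∣ ℚ.< η ℚ.+ η
*-dist {A} {B} a b c d η 0<A 0<B ∣a∣<A ∣d∣<B hab hcd = ℚₚ.≤-<-trans
  (subst (λ z → ℚ.∣ z ∣ ℚ.≤ ℚ.∣ a ℚ.* (c ℚ.- d) ∣ ℚ.+ ℚ.∣ (a ℚ.- b) ℚ.* d ∣)
    (S.solve 4 (λ a b c d → a S.:* (c S.:- d) S.:+ (a S.:- b) S.:* d S.:= a S.:* c S.:- b S.:* d) refl a b c d)
    (ℚₚ.∣p+q∣≤∣p∣+∣q∣ (a ℚ.* (c ℚ.- d)) ((a ℚ.- b) ℚ.* d)))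
  (ℚₚ.+-mono-< left right)
  where
  left : ℚ.∣ a ℚ.* (c ℚ.- d) ∣ ℚ.< η
  left = subst₂ ℚ._<_ (sym (ℚₚ.∣p*q∣≡∣p∣*∣q∣ a (c ℚ.- d))) (*-invℚ-cancel A η 0<A)
    (*-mono-<-nonNeg (ℚₚ.0≤∣p∣ a) ∣a∣<A (ℚₚ.0≤∣p∣ (c ℚ.- d)) hcd)
  right : ℚ.∣ (a ℚ.- b) ℚ.* d ∣ ℚ.< η
  right = subst₂ ℚ._<_ (sym (ℚₚ.∣p*q∣≡∣p∣*∣q∣ (a ℚ.- b) d))
    (trans (ℚₚ.*-comm (η ℚ.* invℚ B) B) (*-invℚ-cancel B η 0<B))
    (*-mono-<-nonNeg (ℚₚ.0≤∣p∣ (a ℚ.- b)) hab (ℚₚ.0≤∣p∣ d) ∣d∣<B)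

*-cauchy : ∀ f g → IsCauchy f → IsCauchy g → IsCauchy (λ n → f n ℚ.* g n)
*-cauchy f g cf cg ε 0<ε = (K ℕ.⊔ L) ℕ.⊔ (K′ ℕ.⊔ L′) , close
  where
  A = proj₁ (cauchy-bound f cf)
  B = proj₁ (cauchy-bound g cg)
  0<A = proj₁ (proj₂ (cauchy-bound f cf))
  0<B = proj₁ (proj₂ (cauchy-bound g cg))
  K = proj₁ (proj₂ (proj₂ (cauchy-bound f cf)))
  L = proj₁ (proj₂ (proj₂ (cauchy-bound g cg)))
  η = ½ ℚ.* ε
  0<η = 0<p*q 0<½ 0<ε
  cf′ = cf (η ℚ.* invℚ B) (0<p*q 0<η (0<invℚ 0<B))
  cg′ = cg (η ℚ.* invℚ A) (0<p*q 0<η (0<invℚ 0<A))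
  K′ = proj₁ cf′
  L′ = proj₁ cg′
  close : ∀ m n → (K ℕ.⊔ L) ℕ.⊔ (K′ ℕ.⊔ L′) ℕ.≤ m → (K ℕ.⊔ L) ℕ.⊔ (K′ ℕ.⊔ L′) ℕ.≤ n →
          ℚ.∣ f m ℚ.* g m ℚ.- f n ℚ.* g n ∣ ℚ.< ε
  close m n p q = subst (ℚ.∣ f m ℚ.* g m ℚ.- f n ℚ.* g n ∣ ℚ.<_) (½+½ ε)
    (*-dist (f m) (f n) (g m) (g n) η 0<A 0<B
      (proj₂ (proj₂ (proj₂ (cauchy-bound f cf))) m (ℕₚ.m⊔n≤o⇒m≤o K L (ℕₚ.m⊔n≤o⇒m≤o (K ℕ.⊔ L) (K′ ℕ.⊔ L′) p)))
      (proj₂ (proj₂ (proj₂ (cauchy-bound g cg))) n (ℕₚ.m⊔n≤o⇒n≤o K L (ℕₚ.m⊔n≤o⇒m≤o (K ℕ.⊔ L) (K′ ℕ.⊔ L′) q)))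
      (proj₂ cf′ m n (ℕₚ.m⊔n≤o⇒m≤o K′ L′ (ℕₚ.m⊔n≤o⇒n≤o (K ℕ.⊔ L) (K′ ℕ.⊔ L′) p))
                     (ℕₚ.m⊔n≤o⇒m≤o K′ L′ (ℕₚ.m⊔n≤o⇒n≤o (K ℕ.⊔ L) (K′ ℕ.⊔ L′) q)))
      (proj₂ cg′ m n (ℕₚ.m⊔n≤o⇒n≤o K′ L′ (ℕₚ.m⊔n≤o⇒n≤o (K ℕ.⊔ L) (K′ ℕ.⊔ L′) p))
                     (ℕₚ.m⊔n≤o⇒n≤o K′ L′ (ℕₚ.m⊔n≤o⇒n≤o (K ℕ.⊔ L) (K′ ℕ.⊔ L′) q))))

infix  8 -_
infixl 7 _*_
infixl 6 _+_ _-_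

_+_ : ℝ → ℝ → ℝ
x + y = mkℝ (λ n → seq x n ℚ.+ seq y n) (+-cauchy (seq x) (seq y) (cauchy x) (cauchy y))

-_ : ℝ → ℝ
- x = mkℝ (λ n → ℚ.- seq x n) (neg-cauchy (seq x) (cauchy x))

_-_ : ℝ → ℝ → ℝ
x - y = x + - y

_*_ : ℝ → ℝ → ℝ
x * y = mkℝ (λ n → seq x n ℚ.* seq y n) (*-cauchy (seq x) (seq y) (cauchy x) (cauchy y))

∣_∣ : ℝ → ℝ
∣ x ∣ = mkℝ (λ n → ℚ.∣ seq x n ∣) (abs-cauchy (seq x) (cauchy x))

inv-cauchy : ∀ x → 0ℝ < x → IsCauchy (λ n → invℚ (seq x n))
inv-cauchy x (mk< e 0<e K hK) ε 0<ε with cauchy x (ε ℚ.* (e ℚ.* e)) (0<p*q 0<ε (0<p*q 0<e 0<e))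
... | L , hL = K ℕ.⊔ L , λ m n p q → invℚ-dist 0<e
  (subst (ℚ._< seq x m) (ℚₚ.+-identityˡ e) (hK m (ℕₚ.m⊔n≤o⇒m≤o K L p)))
  (subst (ℚ._< seq x n) (ℚₚ.+-identityˡ e) (hK n (ℕₚ.m⊔n≤o⇒m≤o K L q)))
  (hL m n (ℕₚ.m⊔n≤o⇒n≤o K L p) (ℕₚ.m⊔n≤o⇒n≤o K L q))

inv : (x : ℝ) → 0ℝ < x → ℝ
inv x 0<x = mkℝ (λ n → invℚ (seq x n)) (inv-cauchy x 0<x)

infixl 7 _÷_⟨_⟩

_÷_⟨_⟩ : (x y : ℝ) → 0ℝ < y → ℝ
x ÷ y ⟨ 0<y ⟩ = x * inv y 0<y

0<x*y : ∀ {x y} → 0ℝ < x → 0ℝ < y → 0ℝ < x * y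
0<x*y {x} {y} (mk< e 0<e K hK) (mk< d 0<d L hL) =
  mk< (e ℚ.* d) (0<p*q 0<e 0<d) (K ℕ.⊔ L) λ n p →
    subst (ℚ._< seq x n ℚ.* seq y n) (sym (ℚₚ.+-identityˡ (e ℚ.* d)))
      (*-mono-<-nonNeg
        (ℚₚ.<⇒≤ 0<e) (subst (ℚ._< seq x n) (ℚₚ.+-identityˡ e) (hK n (ℕₚ.m⊔n≤o⇒m≤o K L p)))
        (ℚₚ.<⇒≤ 0<d) (subst (ℚ._< seq y n) (ℚₚ.+-identityˡ d) (hL n (ℕₚ.m⊔n≤o⇒n≤o K L p))))

0<fromℚ : ∀ {q} → 0ℚ ℚ.< q → 0ℝ < fromℚ q
0<fromℚ {q} 0<q = mk< (½ ℚ.* q) (0<p*q 0<½ 0<q) 0 λ _ _ →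
  subst₂ ℚ._<_ (sym (ℚₚ.+-identityˡ (½ ℚ.* q))) (ℚₚ.*-identityˡ q)
    (ℚₚ.*-monoˡ-<-pos q {{pos 0<q}} ½<1)

0<fromℕ : ∀ n .{{_ : NonZero n}} → 0ℝ < fromℕ n
0<fromℕ n = 0<fromℚ (pos⁻¹ _ (ℚₚ.normalize-pos n 1))

IsSupremum : Pred ℝ 0ℓ → ℝ → Set
IsSupremum S x = (∀ r → S r → r ≤ x) × (∀ u → (∀ r → S r → r ≤ u) → x ≤ u)

recip : ℕ → ℚ
recip k = + 1 / suc k

-- The left Riemann sum of ∫₁^q dt/t with mesh h = 1/(n+1):
-- Σ_{j < (q-1)/h} h / (1 + j h)  =  Σ_{j < (q-1)(n+1)} 1 / (n + 1 + j).
logSum : ℕ → ℕ → ℚ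
logSum q n = sumℚ ((q ℕ.∸ 1) ℕ.* suc n) (λ j → recip (n ℕ.+ j))

recipᵘ : ∀ k → ℚ.toℚᵘ (recip k) ℚᵘ.≃ ℚᵘ.mkℚᵘ (+ 1) k
recipᵘ k = ℚₚ.toℚᵘ-fromℚᵘ (ℚᵘ.mkℚᵘ (+ 1) k)

recip-anti : ∀ {k l} → k ℕ.≤ l → recip l ℚ.≤ recip k
recip-anti {k} {l} k≤l = ℚₚ.toℚᵘ-cancel-≤
  (ℚᵘₚ.≤-trans (ℚᵘₚ.≤-reflexive (recipᵘ l))
    (ℚᵘₚ.≤-trans
      (ℚᵘ.*≤* (subst₂ ℤ._≤_ (sym (ℤₚ.*-identityˡ (+ suc k))) (sym (ℤₚ.*-identityˡ (+ suc l))) (ℤ.+≤+ (ℕ.s≤s k≤l))))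
      (ℚᵘₚ.≤-reflexive (ℚᵘₚ.≃-sym (recipᵘ k)))))

0<recip : ∀ k → 0ℚ ℚ.< recip k
0<recip k = pos⁻¹ _ (ℚₚ.normalize-pos 1 (suc k))

recip-* : ∀ a c → recip (c ℕ.+ a ℕ.* suc c) ≡ recip c ℚ.* recip a
recip-* a c = ℚₚ.toℚᵘ-injective (ℚᵘₚ.≃-trans (recipᵘ (c ℕ.+ a ℕ.* suc c))
  (ℚᵘₚ.≃-trans (ℚᵘ.*≡* (cong (λ z → + 1 ℤ.* + z) (ℕₚ.*-comm (suc c) (suc a))))
  (ℚᵘₚ.≃-trans (ℚᵘₚ.*-cong (ℚᵘₚ.≃-sym (recipᵘ c)) (ℚᵘₚ.≃-sym (recipᵘ a)))
    (ℚᵘₚ.≃-sym (ℚₚ.toℚᵘ-homo-* (recip c) (recip a))))))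

suc/1 : ∀ n → + suc n / 1 ≡ + n / 1 ℚ.+ 1ℚ
suc/1 n = ℚₚ.toℚᵘ-injective (ℚᵘₚ.≃-trans (ℚₚ.toℚᵘ-fromℚᵘ (ℚᵘ.mkℚᵘ (+ suc n) 0))
  (ℚᵘₚ.≃-trans (ℚᵘ.*≡* (cong (ℤ._* + 1) eq))
  (ℚᵘₚ.≃-trans (ℚᵘₚ.+-cong (ℚᵘₚ.≃-sym (ℚₚ.toℚᵘ-fromℚᵘ (ℚᵘ.mkℚᵘ (+ n) 0))) ℚᵘₚ.≃-refl)
    (ℚᵘₚ.≃-sym (ℚₚ.toℚᵘ-homo-+ (+ n / 1) 1ℚ)))))
  where
  eq : + suc n ≡ + n ℤ.* + 1 ℤ.+ + 1
  eq = trans (cong +_ (ℕₚ.+-comm 1 n)) (cong (ℤ._+ + 1) (sym (ℤₚ.*-identityʳ (+ n))))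

suc*recip : ∀ c → + suc c / 1 ℚ.* recip c ≡ 1ℚ
suc*recip c = ℚₚ.toℚᵘ-injective (ℚᵘₚ.≃-trans (ℚₚ.toℚᵘ-homo-* (+ suc c / 1) (recip c))
  (ℚᵘₚ.≃-trans (ℚᵘₚ.*-cong (ℚₚ.toℚᵘ-fromℚᵘ (ℚᵘ.mkℚᵘ (+ suc c) 0)) (recipᵘ c))
    (ℚᵘ.*≡* (cong +_ (eq c)))))
  where
  eq : ∀ c → suc c ℕ.* 1 ℕ.* 1 ≡ 1 ℕ.* (1 ℕ.* suc c)
  eq = solve-∀

sum-mono : ∀ n {f g} → (∀ i → i ℕ.< n → f i ℚ.≤ g i) → sumℚ n f ℚ.≤ sumℚ n g
sum-mono zero    h = ℚₚ.≤-refl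
sum-mono (suc n) h = ℚₚ.+-mono-≤ (sum-mono n (λ i p → h i (ℕₚ.m<n⇒m<1+n p))) (h n ℕₚ.≤-refl)

sum-const : ∀ n t → sumℚ n (λ _ → t) ≡ + n / 1 ℚ.* t
sum-const zero    t = sym (ℚₚ.*-zeroˡ t)
sum-const (suc n) t = trans (cong (ℚ._+ t) (sum-const n t))
  (trans (S.solve 2 (λ a t → a S.:* t S.:+ t S.:= (a S.:+ S.con 1ℚ) S.:* t) refl (+ n / 1) t)
    (cong (ℚ._* t) (sym (suc/1 n))))

sum-avg : ∀ c t → sumℚ (suc c) (λ _ → recip c ℚ.* t) ≡ t
sum-avg c t = trans (sum-const (suc c) (recip c ℚ.* t))
  (trans (sym (ℚₚ.*-assoc (+ suc c / 1) (recip c) t))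
    (trans (cong (ℚ._* t) (suc*recip c)) (ℚₚ.*-identityˡ t)))

sum-+ : ∀ m n f → sumℚ (m ℕ.+ n) f ≡ sumℚ m f ℚ.+ sumℚ n (λ i → f (m ℕ.+ i))
sum-+ m zero    f = trans (cong (λ z → sumℚ z f) (ℕₚ.+-identityʳ m)) (sym (ℚₚ.+-identityʳ (sumℚ m f)))
sum-+ m (suc n) f = trans (cong (λ z → sumℚ z f) (ℕₚ.+-suc m n))
  (trans (cong (ℚ._+ f (m ℕ.+ n)) (sum-+ m n f)) (ℚₚ.+-assoc (sumℚ m f) _ (f (m ℕ.+ n))))

sum-blocks : ∀ M c f → sumℚ (M ℕ.* c) f ≡ sumℚ M (λ i → sumℚ c (λ k → f (i ℕ.* c ℕ.+ k)))
sum-blocks zero    c f = refl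
sum-blocks (suc M) c f = trans (cong (λ z → sumℚ z f) (ℕₚ.+-comm c (M ℕ.* c)))
  (trans (sum-+ (M ℕ.* c) c f) (cong (ℚ._+ sumℚ c (λ k → f (M ℕ.* c ℕ.+ k))) (sum-blocks M c f)))

sum-shift : ∀ M n → sumℚ M (λ i → recip (n ℕ.+ i)) ℚ.≤ sumℚ M (λ i → recip (suc (n ℕ.+ i))) ℚ.+ recip n
sum-shift M n = subst (ℚ._≤ R ℚ.+ recip n)
  (trans (cong (ℚ._- recip (n ℕ.+ M)) (sym (tele M)))
    (S.solve 2 (λ a b → (a S.:+ b) S.:- b S.:= a) refl (sumℚ M (λ i → recip (n ℕ.+ i))) (recip (n ℕ.+ M))))
  (subst (R ℚ.+ recip n ℚ.- recip (n ℕ.+ M) ℚ.≤_) (ℚₚ.+-identityʳ (R ℚ.+ recip n))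
    (ℚₚ.+-monoʳ-≤ (R ℚ.+ recip n) (ℚₚ.neg-antimono-≤ (ℚₚ.<⇒≤ (0<recip (n ℕ.+ M))))))
  where
  R = sumℚ M (λ i → recip (suc (n ℕ.+ i)))
  tele : ∀ M → sumℚ M (λ i → recip (n ℕ.+ i)) ℚ.+ recip (n ℕ.+ M) ≡ sumℚ M (λ i → recip (suc (n ℕ.+ i))) ℚ.+ recip n
  tele zero    = cong (λ z → 0ℚ ℚ.+ recip z) (ℕₚ.+-identityʳ n)
  tele (suc M) = trans (cong₂ ℚ._+_ (tele M) (cong recip (ℕₚ.+-suc n M)))
    (S.solve 3 (λ a b c → (a S.:+ b) S.:+ c S.:= (a S.:+ c) S.:+ b) refl
      (sumℚ M (λ i → recip (suc (n ℕ.+ i)))) (recip n) (recip (suc (n ℕ.+ M))))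

-- Refining the mesh 1/(n+1) to 1/((n+1)(c+1)).
module Refine (q n c : ℕ) where
  p M : ℕ
  p = c ℕ.+ n ℕ.* suc c
  M = (q ℕ.∸ 1) ℕ.* suc n

  blocks : logSum q p ≡ sumℚ M (λ i → sumℚ (suc c) (λ k → recip (p ℕ.+ (i ℕ.* suc c ℕ.+ k))))
  blocks = trans
    (cong (λ z → sumℚ z (λ j → recip (p ℕ.+ j))) (sym (ℕₚ.*-assoc (q ℕ.∸ 1) (suc n) (suc c))))
    (sum-blocks M (suc c) (λ j → recip (p ℕ.+ j)))

  idx : ∀ n c i k → c ℕ.+ n ℕ.* suc c ℕ.+ (i ℕ.* suc c ℕ.+ k) ≡ c ℕ.+ (n ℕ.+ i) ℕ.* suc c ℕ.+ k
  idx = solve-∀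

  upper : logSum q p ℚ.≤ logSum q n
  upper = subst (ℚ._≤ logSum q n) (sym blocks) (sum-mono M λ i _ →
    subst (sumℚ (suc c) (λ k → recip (p ℕ.+ (i ℕ.* suc c ℕ.+ k))) ℚ.≤_) (sum-avg c (recip (n ℕ.+ i)))
      (sum-mono (suc c) λ k _ →
        subst (recip (p ℕ.+ (i ℕ.* suc c ℕ.+ k)) ℚ.≤_) (recip-* (n ℕ.+ i) c)
          (recip-anti (subst (c ℕ.+ (n ℕ.+ i) ℕ.* suc c ℕ.≤_) (sym (idx n c i k)) (ℕₚ.m≤m+n _ k)))))

  idx′ : ∀ a c → c ℕ.+ a ℕ.* suc c ℕ.+ suc c ≡ c ℕ.+ suc a ℕ.* suc c
  idx′ = solve-∀

  lower : sumℚ M (λ i → recip (suc (n ℕ.+ i))) ℚ.≤ logSum q p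
  lower = subst (sumℚ M (λ i → recip (suc (n ℕ.+ i))) ℚ.≤_) (sym blocks) (sum-mono M λ i _ →
    subst (ℚ._≤ sumℚ (suc c) (λ k → recip (p ℕ.+ (i ℕ.* suc c ℕ.+ k)))) (sum-avg c (recip (suc (n ℕ.+ i))))
      (sum-mono (suc c) λ k k<c →
        subst (ℚ._≤ recip (p ℕ.+ (i ℕ.* suc c ℕ.+ k))) (recip-* (suc (n ℕ.+ i)) c)
          (recip-anti (subst₂ ℕ._≤_ (sym (idx n c i k)) (idx′ (n ℕ.+ i) c)
            (ℕₚ.+-monoʳ-≤ (c ℕ.+ (n ℕ.+ i) ℕ.* suc c) (ℕₚ.<⇒≤ k<c))))))

  close : logSum q n ℚ.≤ logSum q p ℚ.+ recip n
  close = ℚₚ.≤-trans (sum-shift M n) (ℚₚ.+-monoˡ-≤ (recip n) lower)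

logSum-dist : ∀ q m n → logSum q m ℚ.- logSum q n ℚ.≤ recip m
logSum-dist q m n = subst (logSum q m ℚ.- logSum q n ℚ.≤_)
  (S.solve 2 (λ a b → (a S.:+ b) S.:- a S.:= b) refl (logSum q n) (recip m))
  (ℚₚ.+-monoˡ-≤ (ℚ.- logSum q n) (ℚₚ.≤-trans (Refine.close q m n)
    (ℚₚ.+-monoˡ-≤ (recip m) (subst (λ z → logSum q z ℚ.≤ logSum q n)
      (ℕₚ.suc-injective (ℕₚ.*-comm (suc n) (suc m))) (Refine.upper q n m)))))

archimedean : ∀ ε → 0ℚ ℚ.< ε → ∃[ K ] recip K ℚ.< ε
archimedean (mkℚ +[1+ k ] d c) _ = suc d , ℚₚ.toℚᵘ-cancel-<
  (ℚᵘₚ.≤-<-trans (ℚᵘₚ.≤-reflexive (recipᵘ (suc d)))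
    (ℚᵘ.*<* (ℤ.+<+ (ℕₚ.<-≤-trans
      (subst (ℕ._< suc (suc d)) (sym (ℕₚ.*-identityˡ (suc d))) ℕₚ.≤-refl)
      (ℕₚ.m≤m+n (suc (suc d)) (k ℕ.* suc (suc d)))))))
archimedean (mkℚ +0 d c) (ℚ.*<* h) = contradiction h (ℤₚ.<-irrefl refl)
archimedean (mkℚ -[1+ k ] d c) (ℚ.*<* ())

log-cauchy : ∀ q → IsCauchy (logSum q)
log-cauchy q ε 0<ε with archimedean ε 0<ε
... | K , hK = K , λ m n p r → ∣p∣<q
  (ℚₚ.≤-<-trans (ℚₚ.≤-trans (logSum-dist q m n) (recip-anti p)) hK)
  (subst (ℚ._< ε) (S.solve 2 (λ a b → b S.:- a S.:= S.:- (a S.:- b)) refl (logSum q m) (logSum q n))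
    (ℚₚ.≤-<-trans (ℚₚ.≤-trans (logSum-dist q n m) (recip-anti r)) hK))

-- The natural logarithm at a positive integer, as ∫₁^q dt/t.
log : (q : ℕ) .{{_ : NonZero q}} → ℝ
log q = mkℝ (logSum q) (log-cauchy q)

½≤logSum2 : ∀ n → recip 1 ℚ.≤ logSum 2 n
½≤logSum2 n = subst₂ ℚ._≤_ (sum-avg n (recip 1))
  (cong (λ z → sumℚ z (λ j → recip (n ℕ.+ j))) (sym (ℕₚ.*-identityˡ (suc n))))
  (sum-mono (suc n) λ j j<n → subst (ℚ._≤ recip (n ℕ.+ j)) (recip-* 1 n)
    (recip-anti (ℕₚ.+-monoʳ-≤ n (ℕₚ.≤-trans (ℕₚ.<⇒≤ j<n) (ℕₚ.≤-reflexive (sym (ℕₚ.*-identityˡ (suc n))))))))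

0<log2 : 0ℝ < log 2
0<log2 = mk< (recip 3) (0<recip 3) 0 λ n _ →
  ℚₚ.<-≤-trans (ℚ.*<* (ℤ.+<+ (ℕ.s≤s (ℕ.s≤s (ℕ.s≤s ℕ.z≤n))))) (½≤logSum2 n)

0<16*log2 : 0ℝ < fromℕ 16 * log 2
0<16*log2 = 0<x*y {fromℕ 16} {log 2} (0<fromℕ 16) 0<log2

Point : ℕ → Set
Point s = Vector ℝ s

sum : ∀ {n} → Vector ℝ n → ℝ
sum = foldr _+_ 0ℝ

product : ∀ {n} → Vector ℝ n → ℝ
product = foldr _*_ 1ℝ

infix 4 _∈[0,_⟩

_∈[0,_⟩ : ∀ {s} → Point s → Point s → Set
x ∈[0, y ⟩ = ∀ i → 0ℝ ≤ x i × x i < y i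

χ : {A : Set} → Dec A → ℝ
χ A? = if does A? then 1ℝ else 0ℝ

-- Order on ℝ is not decidable constructively, so the values of the indicator
-- function are supplied as decisions of the membership statements; the result
-- does not depend on which decisions are supplied.
Δ : ∀ {N s} (y : Point s) (x : Fin N → Point s) → (∀ n → Dec (x n ∈[0, y ⟩)) → ℝ
Δ y x in? = sum λ n → χ (in? n) - product y

normalizedΔ : ∀ {N s} .{{_ : NonZero N}} (y : Point s) (x : Fin N → Point s) → (∀ n → Dec (x n ∈[0, y ⟩)) → ℝ
normalizedΔ {N} y x in? = fromℚ (+ 1 / N) * Δ y x in?

-- Classically in? always exists, so y ranges over all of [0,1)ˢ.
IsStarDiscrepancy : ∀ {N s} .{{_ : NonZero N}} → (Fin N → Point s) → ℝ → Set
IsStarDiscrepancy {s = s} x = IsSupremum λ r →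
  Σ[ y ∈ Point s ] (∀ i → 0ℝ ≤ y i × y i < 1ℝ) ×
  Σ[ in? ∈ (∀ n → Dec (x n ∈[0, y ⟩)) ] r ≃ ∣ normalizedΔ y x in? ∣

^-nonZero : ∀ b d .{{_ : NonTrivial b}} → NonZero (b ℕ.^ d)
^-nonZero b d = ℕₚ.m^n≢0 b d {{ℕ.nonTrivial⇒nonZero b}}

infixl 8 _^-_

_^-_ : (b d : ℕ) .{{_ : NonTrivial b}} → ℚ
b ^- d = (+ 1 / b ℕ.^ d) {{^-nonZero b d}}

module _ (b : ℕ) .{{_ : NonTrivial b}} {s : ℕ} (d : Vector ℕ s) where

  _∈elementaryInterval_ : Point s → ((i : Fin s) → Fin (b ℕ.^ d i)) → Set
  x ∈elementaryInterval a = ∀ i →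
    fromℚ ((+ toℕ (a i) / 1) ℚ.* b ^- d i) ≤ x i × x i < fromℚ ((+ suc (toℕ (a i)) / 1) ℚ.* b ^- d i)

  volume : ℚ
  volume = foldr ℚ._*_ 1ℚ (λ i → b ^- d i)

-- A subset of Fin N of known cardinality is decidable, so P? is no restriction.
HoldsForExactly : ∀ {N} → ℕ → Pred (Fin N) 0ℓ → Set
HoldsForExactly {N} k P = Σ[ P? ∈ Decidable P ] length (filter P? (allFin N)) ≡ k

record IsNet (t m s b : ℕ) .{{_ : NonTrivial b}} (x : Fin (b ℕ.^ m) → Point s) : Set where
  field
    1≤s : 1 ℕ.≤ s
    t≤m : t ℕ.≤ m
    inUnitCube : ∀ n i → 0ℝ ≤ x n i × x n i < 1ℝ
    equidistributed : ∀ (d : Vector ℕ s) (a : (i : Fin s) → Fin (b ℕ.^ d i)) →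
      volume b d ≡ b ^- (m ℕ.∸ t) →
      HoldsForExactly (b ℕ.^ t) (λ n → _∈elementaryInterval_ b d (x n) a)

γ₁ γ₂ : ℕ → ℚ
γ₁ m = sumℚ (m ℕ./ 4) (λ j → 2 ^- (2 ℕ.* suc j))
γ₂ m = sumℚ (m ℕ./ 4) (λ j → 2 ^- (m ℕ./ 2 ℕ.+ 2 ℕ.* suc j))

γ : ℕ → Point 2
γ m = fromℚ (γ₁ m) ∷ fromℚ (γ₂ m) ∷ []

first : ∀ m → Fin (2 ℕ.^ m)
first m = fromℕ< (ℕₚ.m^n>0 2 m)

{-# OPTIONS --safe #-}

-- Write m = 4k. Cut [0, γ⁽¹⁾) at the partial sums of γ⁽¹⁾ into k columns; the j-th (j < k) has
-- width 4^-(j+1). Its part below the (k-j-1)-th partial sum of γ⁽²⁾ is a union of elementary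
-- intervals of volume 1/N, each with exactly one point; its part above lies in an elementary
-- interval of volume 1/N that also contains γ = x₀, and so contains no point at all.
-- Hence J_γ contains at most Σ_{r<k} (4ʳ-1)/3 points, which falls short of N γ⁽¹⁾ γ⁽²⁾ by at
-- least k/4 = m/16. The bound on D* follows from log N ≤ m log 2, which holds already for the
-- Riemann sums defining the two logarithms.

module Submission where

open import Defs
open import Data.Bool.Base using (true; false)
open import Data.Fin.Base as Fin using (Fin; fromℕ<)
import Data.Fin.Properties as Finₚ
open import Data.Integer.Base using (+_)
open import Data.List.Base using (List; []; _∷_; _++_; length; filter; tabulate; allFin; lookup)
import Data.List.Properties as Listₚ
open import Data.List.Membership.DecPropositional using (_∈?_)
open import Data.List.Membership.Propositional using (_∈_)
open import Data.List.Membership.Propositional.Properties using (∈-filter⁺; ∈-filter⁻; ∈-allFin; ∈-++⁺ˡ; ∈-++⁺ʳ; ∈-lookup)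
open import Data.List.Relation.Unary.All as All using (All; []; _∷_)
import Data.List.Relation.Unary.All.Properties as Allₚ
open import Data.List.Relation.Unary.AllPairs using (_∷_)
open import Data.List.Relation.Unary.Any using (here; index)
import Data.List.Relation.Unary.Any.Properties as Anyₚ
open import Data.List.Relation.Unary.Unique.Propositional using (Unique)
import Data.List.Relation.Unary.Unique.Propositional.Properties as Uniqueₚ
open import Data.Nat.Base as ℕ using (ℕ; zero; suc; NonZero; z≤n; s≤s)
open import Data.Nat.Divisibility using (_∣_; divides)
import Data.Nat.DivMod as DivMod
import Data.Nat.Properties as ℕₚ
open import Data.Nat.Tactic.RingSolver using (solve-∀)
open import Data.Product.Base using (_×_; _,_; ∃-syntax; Σ-syntax; proj₁; proj₂)
open import Data.Rational.Base as ℚ using (ℚ; _/_; 0ℚ; 1ℚ; ½)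
import Data.Rational.Properties as ℚₚ
open import Data.Rational.Solver using (module +-*-Solver)
open import Data.Sum.Base using (inj₁; inj₂)
import Data.Vec.Functional as Vector
open import Function.Base using (_∘_)
open import Level using (0ℓ)
open import Relation.Binary.PropositionalEquality using (_≡_; refl; sym; trans; cong; cong₂; subst; subst₂; module ≡-Reasoning)
open import Relation.Nullary.Decidable using (Dec; yes; no; does; decidable-stable)
open import Relation.Nullary.Negation using (¬_; contradiction)
open import Relation.Unary using (Pred; Decidable)

private
  module S = +-*-Solver

-- Dyadic rationals.

ι : ℕ → ℚ
ι n = + n / 1

ι-+ : ∀ m n → ι (m ℕ.+ n) ≡ ι m ℚ.+ ι n
ι-+ zero    n = sym (ℚₚ.+-identityˡ (ι n))
ι-+ (suc m) n = begin
  ι (suc (m ℕ.+ n))        ≡⟨ suc/1 (m ℕ.+ n) ⟩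
  ι (m ℕ.+ n) ℚ.+ 1ℚ       ≡⟨ cong (ℚ._+ 1ℚ) (ι-+ m n) ⟩
  ι m ℚ.+ ι n ℚ.+ 1ℚ       ≡⟨ S.solve 2 (λ a b → a S.:+ b S.:+ S.con 1ℚ S.:= (a S.:+ S.con 1ℚ) S.:+ b) refl (ι m) (ι n) ⟩
  ι m ℚ.+ 1ℚ ℚ.+ ι n       ≡⟨ cong (ℚ._+ ι n) (suc/1 m) ⟨
  ι (suc m) ℚ.+ ι n        ∎
  where open ≡-Reasoning

ι-* : ∀ m n → ι (m ℕ.* n) ≡ ι m ℚ.* ι n
ι-* zero    n = sym (ℚₚ.*-zeroˡ (ι n))
ι-* (suc m) n = begin
  ι (n ℕ.+ m ℕ.* n)        ≡⟨ ι-+ n (m ℕ.* n) ⟩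
  ι n ℚ.+ ι (m ℕ.* n)      ≡⟨ cong (ι n ℚ.+_) (ι-* m n) ⟩
  ι n ℚ.+ ι m ℚ.* ι n      ≡⟨ S.solve 2 (λ a b → b S.:+ a S.:* b S.:= (a S.:+ S.con 1ℚ) S.:* b) refl (ι m) (ι n) ⟩
  (ι m ℚ.+ 1ℚ) ℚ.* ι n     ≡⟨ cong (ℚ._* ι n) (suc/1 m) ⟨
  ι (suc m) ℚ.* ι n        ∎
  where open ≡-Reasoning

ι-mono-< : ∀ {m n} → m ℕ.< n → ι m ℚ.< ι n
ι-mono-< {m} {n} m<n with ℕₚ.m≤n⇒∃[o]m+o≡n m<n
... | o , refl = subst₂ ℚ._<_ (ℚₚ.+-identityʳ (ι m)) eq
      (ℚₚ.+-monoʳ-< (ι m) (pos⁻¹ (ι (suc o)) (ℚₚ.normalize-pos (suc o) 1)))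
  where
  eq : ι m ℚ.+ ι (suc o) ≡ ι (suc m ℕ.+ o)
  eq = trans (sym (ι-+ m (suc o))) (cong ι (ℕₚ.+-suc m o))

ι-mono-≤ : ∀ {m n} → m ℕ.≤ n → ι m ℚ.≤ ι n
ι-mono-≤ {m} {n} m≤n with ℕₚ.m≤n⇒m<n∨m≡n m≤n
... | inj₁ m<n  = ℚₚ.<⇒≤ (ι-mono-< m<n)
... | inj₂ refl = ℚₚ.≤-refl

ι-inverseʳ : ∀ n .{{_ : NonZero n}} → ι n ℚ.* (+ 1 / n) ≡ 1ℚ
ι-inverseʳ (suc c) = suc*recip c

*-cancel-inverse : ∀ {p q r} → p ℚ.* q ≡ 1ℚ → p ℚ.* r ≡ 1ℚ → q ≡ r
*-cancel-inverse {p} {q} {r} pq pr = begin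
  q                    ≡⟨ ℚₚ.*-identityʳ q ⟨
  q ℚ.* 1ℚ             ≡⟨ cong (q ℚ.*_) pr ⟨
  q ℚ.* (p ℚ.* r)      ≡⟨ S.solve 3 (λ p q r → q S.:* (p S.:* r) S.:= p S.:* q S.:* r) refl p q r ⟩
  p ℚ.* q ℚ.* r        ≡⟨ cong (ℚ._* r) pq ⟩
  1ℚ ℚ.* r             ≡⟨ ℚₚ.*-identityˡ r ⟩
  r                    ∎
  where open ≡-Reasoning

2^*2^- : ∀ d → ι (2 ℕ.^ d) ℚ.* 2 ^- d ≡ 1ℚ
2^*2^- d = ι-inverseʳ (2 ℕ.^ d) {{^-nonZero 2 d}}

2^-distrib-+ : ∀ d e → 2 ^- (d ℕ.+ e) ≡ 2 ^- d ℚ.* 2 ^- e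
2^-distrib-+ d e = *-cancel-inverse {ι (2 ℕ.^ (d ℕ.+ e))} (2^*2^- (d ℕ.+ e)) (begin
  ι (2 ℕ.^ (d ℕ.+ e)) ℚ.* (2 ^- d ℚ.* 2 ^- e)
    ≡⟨ cong (ℚ._* (2 ^- d ℚ.* 2 ^- e)) (trans (cong ι (ℕₚ.^-distribˡ-+-* 2 d e)) (ι-* (2 ℕ.^ d) (2 ℕ.^ e))) ⟩
  ι (2 ℕ.^ d) ℚ.* ι (2 ℕ.^ e) ℚ.* (2 ^- d ℚ.* 2 ^- e)
    ≡⟨ S.solve 4 (λ a b c d → a S.:* b S.:* (c S.:* d) S.:= (a S.:* c) S.:* (b S.:* d)) refl (ι (2 ℕ.^ d)) (ι (2 ℕ.^ e)) (2 ^- d) (2 ^- e) ⟩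
  (ι (2 ℕ.^ d) ℚ.* 2 ^- d) ℚ.* (ι (2 ℕ.^ e) ℚ.* 2 ^- e)
    ≡⟨ cong₂ ℚ._*_ (2^*2^- d) (2^*2^- e) ⟩
  1ℚ ∎)
  where open ≡-Reasoning

0<2^- : ∀ d → 0ℚ ℚ.< 2 ^- d
0<2^- d = pos⁻¹ _ (ℚₚ.normalize-pos 1 (2 ℕ.^ d) {{^-nonZero 2 d}})

dyadic : ℕ → ℕ → ℚ
dyadic u d = ι u ℚ.* 2 ^- d

dyadic-scale : ∀ u d e → dyadic u d ≡ dyadic (u ℕ.* 2 ℕ.^ e) (d ℕ.+ e)
dyadic-scale u d e = sym (begin
  ι (u ℕ.* 2 ℕ.^ e) ℚ.* 2 ^- (d ℕ.+ e)
    ≡⟨ cong₂ ℚ._*_ (ι-* u (2 ℕ.^ e)) (2^-distrib-+ d e) ⟩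
  ι u ℚ.* ι (2 ℕ.^ e) ℚ.* (2 ^- d ℚ.* 2 ^- e)
    ≡⟨ S.solve 4 (λ a b c d → a S.:* b S.:* (c S.:* d) S.:= (a S.:* c) S.:* (b S.:* d)) refl (ι u) (ι (2 ℕ.^ e)) (2 ^- d) (2 ^- e) ⟩
  dyadic u d ℚ.* (ι (2 ℕ.^ e) ℚ.* 2 ^- e)
    ≡⟨ cong (dyadic u d ℚ.*_) (2^*2^- e) ⟩
  dyadic u d ℚ.* 1ℚ
    ≡⟨ ℚₚ.*-identityʳ (dyadic u d) ⟩
  dyadic u d ∎)
  where open ≡-Reasoning

dyadic-+ : ∀ u v d → dyadic (u ℕ.+ v) d ≡ dyadic u d ℚ.+ dyadic v d
dyadic-+ u v d = trans (cong (ℚ._* 2 ^- d) (ι-+ u v)) (ℚₚ.*-distribʳ-+ (2 ^- d) (ι u) (ι v))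

dyadic-* : ∀ u v d e → dyadic (u ℕ.* v) (d ℕ.+ e) ≡ dyadic u d ℚ.* dyadic v e
dyadic-* u v d e = trans (cong₂ ℚ._*_ (ι-* u v) (2^-distrib-+ d e))
  (S.solve 4 (λ a b c d → a S.:* b S.:* (c S.:* d) S.:= (a S.:* c) S.:* (b S.:* d)) refl (ι u) (ι v) (2 ^- d) (2 ^- e))

dyadic-monoˡ-≤ : ∀ d {u v} → u ℕ.≤ v → dyadic u d ℚ.≤ dyadic v d
dyadic-monoˡ-≤ d u≤v = ℚₚ.*-monoʳ-≤-nonNeg (2 ^- d) {{ℚ.nonNegative (ℚₚ.<⇒≤ (0<2^- d))}} (ι-mono-≤ u≤v)

dyadic-monoˡ-< : ∀ d {u v} → u ℕ.< v → dyadic u d ℚ.< dyadic v d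
dyadic-monoˡ-< d u<v = ℚₚ.*-monoˡ-<-pos (2 ^- d) {{pos (0<2^- d)}} (ι-mono-< u<v)

private
  commonDenominator : ∀ c v d e → dyadic (v ℕ.* 2 ℕ.^ d) (c ℕ.+ d ℕ.+ e) ≡ dyadic v (c ℕ.+ e)
  commonDenominator c v d e = trans (cong (dyadic (v ℕ.* 2 ℕ.^ d)) (eq c d e)) (sym (dyadic-scale v (c ℕ.+ e) d))
    where
    eq : ∀ c d e → c ℕ.+ d ℕ.+ e ≡ c ℕ.+ e ℕ.+ d
    eq = solve-∀

-- Cross-multiplication. The common exponent `c` cancels and so stays out of the hypothesis; `c = 0`
-- serves the first coordinate of γ and `c = 2k` the second, whose digits are the same but shifted
-- by m/2 = 2k places.
dyadic-mono-≤ : ∀ c u v d e → u ℕ.* 2 ℕ.^ e ℕ.≤ v ℕ.* 2 ℕ.^ d → dyadic u (c ℕ.+ d) ℚ.≤ dyadic v (c ℕ.+ e)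
dyadic-mono-≤ c u v d e h = subst₂ ℚ._≤_ (sym (dyadic-scale u (c ℕ.+ d) e)) (commonDenominator c v d e)
  (dyadic-monoˡ-≤ (c ℕ.+ d ℕ.+ e) h)

dyadic-mono-< : ∀ c u v d e → u ℕ.* 2 ℕ.^ e ℕ.< v ℕ.* 2 ℕ.^ d → dyadic u (c ℕ.+ d) ℚ.< dyadic v (c ℕ.+ e)
dyadic-mono-< c u v d e h = subst₂ ℚ._<_ (sym (dyadic-scale u (c ℕ.+ d) e)) (commonDenominator c v d e)
  (dyadic-monoˡ-< (c ℕ.+ d ℕ.+ e) h)

-- Base-4 repunits and the truncations of γ.

-- (4ʳ − 1) / 3, the number with r base-4 digits all equal to 1.
repunit : ℕ → ℕ
repunit zero    = 0
repunit (suc r) = suc (4 ℕ.* repunit r)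

2*suc : ∀ r → 2 ℕ.* suc r ≡ suc (suc (2 ℕ.* r))
2*suc = solve-∀

repunit-closed : ∀ r → 2 ℕ.^ (2 ℕ.* r) ≡ suc (3 ℕ.* repunit r)
repunit-closed zero    = refl
repunit-closed (suc r) = begin
  2 ℕ.^ (2 ℕ.* suc r)                ≡⟨ cong (2 ℕ.^_) (2*suc r) ⟩
  2 ℕ.* (2 ℕ.* 2 ℕ.^ (2 ℕ.* r))      ≡⟨ cong (λ z → 2 ℕ.* (2 ℕ.* z)) (repunit-closed r) ⟩
  2 ℕ.* (2 ℕ.* suc (3 ℕ.* repunit r)) ≡⟨ eq (repunit r) ⟩
  suc (3 ℕ.* repunit (suc r))        ∎
  where
  open ≡-Reasoning
  eq : ∀ a → 2 ℕ.* (2 ℕ.* suc (3 ℕ.* a)) ≡ suc (3 ℕ.* suc (4 ℕ.* a))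
  eq = solve-∀

repunit-mono-≤ : ∀ {r s} → r ℕ.≤ s → repunit r ℕ.≤ repunit s
repunit-mono-≤ z≤n       = z≤n
repunit-mono-≤ (s≤s r≤s) = s≤s (ℕₚ.*-monoʳ-≤ 4 (repunit-mono-≤ r≤s))

repunit<2^ : ∀ r → repunit r ℕ.< 2 ℕ.^ (2 ℕ.* r)
repunit<2^ r = subst (repunit r ℕ.<_) (sym (repunit-closed r)) (s≤s (ℕₚ.m≤n*m (repunit r) 3))

-- Past the first `c` binary places, the summands put a digit 1 in every second place, that is, a 1
-- in every base-4 place. Appending one such digit turns the numerator a into 4a + 1.
repunit-sum : ∀ c r → sumℚ r (λ j → 2 ^- (c ℕ.+ 2 ℕ.* suc j)) ≡ dyadic (repunit r) (c ℕ.+ 2 ℕ.* r)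
repunit-sum c zero    = sym (ℚₚ.*-zeroˡ (2 ^- (c ℕ.+ 0)))
repunit-sum c (suc r) = begin
  sumℚ r (λ j → 2 ^- (c ℕ.+ 2 ℕ.* suc j)) ℚ.+ 2 ^- D
    ≡⟨ cong₂ ℚ._+_ (repunit-sum c r) (sym (ℚₚ.*-identityˡ (2 ^- D))) ⟩
  dyadic (repunit r) (c ℕ.+ 2 ℕ.* r) ℚ.+ dyadic 1 D
    ≡⟨ cong (ℚ._+ dyadic 1 D) (trans (dyadic-scale (repunit r) (c ℕ.+ 2 ℕ.* r) 2) (cong₂ dyadic (ℕₚ.*-comm (repunit r) 4) (eq c r))) ⟩
  dyadic (4 ℕ.* repunit r) D ℚ.+ dyadic 1 D
    ≡⟨ ℚₚ.+-comm (dyadic (4 ℕ.* repunit r) D) (dyadic 1 D) ⟩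
  dyadic 1 D ℚ.+ dyadic (4 ℕ.* repunit r) D
    ≡⟨ dyadic-+ 1 (4 ℕ.* repunit r) D ⟨
  dyadic (repunit (suc r)) D ∎
  where
  open ≡-Reasoning
  D = c ℕ.+ 2 ℕ.* suc r
  eq : ∀ c r → c ℕ.+ 2 ℕ.* r ℕ.+ 2 ≡ c ℕ.+ 2 ℕ.* suc r
  eq = solve-∀

γ₁-dyadic : ∀ k → γ₁ (k ℕ.* 4) ≡ dyadic (repunit k) (2 ℕ.* k)
γ₁-dyadic k rewrite DivMod.m*n/n≡m k 4 {{_}} = repunit-sum 0 k

k*4/2≡2*k : ∀ k → k ℕ.* 4 ℕ./ 2 ≡ 2 ℕ.* k
k*4/2≡2*k k = trans (cong (ℕ._/ 2) (eq k)) (DivMod.m*n/n≡m (2 ℕ.* k) 2)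
  where
  eq : ∀ k → k ℕ.* 4 ≡ 2 ℕ.* k ℕ.* 2
  eq = solve-∀

γ₂-dyadic : ∀ k → γ₂ (k ℕ.* 4) ≡ dyadic (repunit k) (2 ℕ.* k ℕ.+ 2 ℕ.* k)
γ₂-dyadic k rewrite DivMod.m*n/n≡m k 4 {{_}} | k*4/2≡2*k k = repunit-sum (2 ℕ.* k) k

-- With 4ⁱ = 3a + 1 and 4ʲ = 3b + 1, cross-multiplying leaves a + 3ab ≤ b + 3ab.
truncation-mono : ∀ c {i j} → i ℕ.≤ j → dyadic (repunit i) (c ℕ.+ 2 ℕ.* i) ℚ.≤ dyadic (repunit j) (c ℕ.+ 2 ℕ.* j)
truncation-mono c {i} {j} i≤j = dyadic-mono-≤ c a b (2 ℕ.* i) (2 ℕ.* j) (subst₂ ℕ._≤_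
  (trans (eq a b) (cong (a ℕ.*_) (sym (repunit-closed j))))
  (trans (cong (b ℕ.+_) (cong (3 ℕ.*_) (ℕₚ.*-comm a b))) (trans (eq b a) (cong (b ℕ.*_) (sym (repunit-closed i)))))
  (ℕₚ.+-monoˡ-≤ (3 ℕ.* (a ℕ.* b)) (repunit-mono-≤ i≤j)))
  where
  a = repunit i
  b = repunit j
  eq : ∀ a b → a ℕ.+ 3 ℕ.* (a ℕ.* b) ≡ a ℕ.* suc (3 ℕ.* b)
  eq = solve-∀

-- All truncations lie below ⅓, hence below any truncation rounded up at the next binary digit.
truncation-< : ∀ c i j → dyadic (repunit i) (c ℕ.+ 2 ℕ.* i) ℚ.< dyadic (suc (2 ℕ.* repunit j)) (suc (c ℕ.+ 2 ℕ.* j))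
truncation-< c i j = subst (λ d → dyadic (repunit i) (c ℕ.+ 2 ℕ.* i) ℚ.< dyadic (suc (2 ℕ.* repunit j)) d)
  (ℕₚ.+-suc c (2 ℕ.* j))
  (dyadic-mono-< c a (suc (2 ℕ.* b)) (2 ℕ.* i) (suc (2 ℕ.* j))
    (subst₂ ℕ._<_ (cong (λ z → a ℕ.* (2 ℕ.* z)) (sym (repunit-closed j)))
      (cong (suc (2 ℕ.* b) ℕ.*_) (sym (repunit-closed i)))
      (subst (a ℕ.* (2 ℕ.* suc (3 ℕ.* b)) ℕ.<_) (eq a b) (s≤s (ℕₚ.m≤m+n _ (a ℕ.+ 2 ℕ.* b))))))
  where
  a = repunit i
  b = repunit j
  eq : ∀ a b → suc (a ℕ.* (2 ℕ.* suc (3 ℕ.* b)) ℕ.+ (a ℕ.+ 2 ℕ.* b)) ≡ suc (2 ℕ.* b) ℕ.* suc (3 ℕ.* a)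
  eq = solve-∀

-- The integer inequality behind the deficit.

sumℕ : ℕ → (ℕ → ℕ) → ℕ
sumℕ zero    f = 0
sumℕ (suc n) f = sumℕ n f ℕ.+ f n

sumℕ-1 : ∀ n → sumℕ n (λ _ → 1) ≡ n
sumℕ-1 zero    = refl
sumℕ-1 (suc n) = trans (cong (ℕ._+ 1) (sumℕ-1 n)) (ℕₚ.+-comm n 1)

-- Telescoping: consecutive repunits differ by 3 · `repunit k` + 1. This ties the number of cells to
-- the numerator of γ.
sum-repunit : ∀ k → repunit k ≡ 3 ℕ.* sumℕ k repunit ℕ.+ k
sum-repunit zero    = refl
sum-repunit (suc k) = begin
  suc (4 ℕ.* a)                     ≡⟨ cong (λ z → suc (z ℕ.+ 3 ℕ.* a)) (sum-repunit k) ⟩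
  suc (3 ℕ.* s ℕ.+ k ℕ.+ 3 ℕ.* a)   ≡⟨ eq a s k ⟩
  3 ℕ.* (s ℕ.+ a) ℕ.+ suc k         ∎
  where
  open ≡-Reasoning
  a = repunit k
  s = sumℕ k repunit
  eq : ∀ a s k → suc (3 ℕ.* s ℕ.+ k ℕ.+ 3 ℕ.* a) ≡ 3 ℕ.* (s ℕ.+ a) ℕ.+ suc k
  eq = solve-∀

-- With s = Σ_{r<k} repunit r, the difference of the two sides is 3sk + k² − 4s − k.
deficit : ∀ k → (4 ℕ.* sumℕ k repunit ℕ.+ k) ℕ.* 2 ℕ.^ (2 ℕ.* k) ℕ.≤ repunit k ℕ.* repunit k ℕ.* 4
deficit zero          = z≤n
deficit (suc zero)    = ℕₚ.≤-refl
deficit k@(suc (suc l)) = subst₂ (λ a p → (4 ℕ.* s ℕ.+ k) ℕ.* p ℕ.≤ a ℕ.* a ℕ.* 4)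
  (sym (sum-repunit k))
  (sym (trans (repunit-closed k) (cong (λ a → suc (3 ℕ.* a)) (sum-repunit k))))
  (subst (lhs ℕ.≤_) (eq s l) (ℕₚ.m≤m+n lhs _))
  where
  s = sumℕ k repunit
  lhs = (4 ℕ.* s ℕ.+ k) ℕ.* suc (3 ℕ.* (3 ℕ.* s ℕ.+ k))
  eq : ∀ s l → let k = suc (suc l) in
    (4 ℕ.* s ℕ.+ k) ℕ.* suc (3 ℕ.* (3 ℕ.* s ℕ.+ k)) ℕ.+ (2 ℕ.* s ℕ.+ 3 ℕ.* s ℕ.* l ℕ.+ suc l ℕ.* k)
      ≡ (3 ℕ.* s ℕ.+ k) ℕ.* (3 ℕ.* s ℕ.+ k) ℕ.* 4
  eq = solve-∀

-- Comparing reals with rationals.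

<-≤-fromℚ : ∀ {x a b} → x < fromℚ a → a ℚ.≤ b → x < fromℚ b
<-≤-fromℚ (mk< g 0<g K sep) a≤b = mk< g 0<g K λ n K≤n → ℚₚ.<-≤-trans (sep n K≤n) a≤b

≃-refl : ∀ {x} → x ≃ x
≃-refl {x} ε 0<ε = 0 , λ n _ → subst (ℚ._< ε) (sym (cong ℚ.∣_∣ (ℚₚ.+-inverseʳ (seq x n)))) 0<ε

-- Far enough out, the sequence of `x` would be both within the gap `g` of `a` and more than `g`
-- below it. This and the next two lemmas are what turns x₀ ≃ γ into order statements about x₀.
≃⇒≮ : ∀ {x a} → x ≃ fromℚ a → ¬ (x < fromℚ a)
≃⇒≮ {x} {a} x≃a (mk< g 0<g K sep) with x≃a g 0<g
... | L , close = ℚₚ.<-irrefl refl (begin-strict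
  g                          ≡⟨ S.solve 2 (λ x g → g S.:= (x S.:+ g) S.:- x) refl xₙ g ⟩
  (xₙ ℚ.+ g) ℚ.- xₙ          <⟨ ℚₚ.+-monoˡ-< (ℚ.- xₙ) (sep n (ℕₚ.m≤m⊔n K L)) ⟩
  a ℚ.- xₙ                   ≤⟨ p≤∣p∣ (a ℚ.- xₙ) ⟩
  ℚ.∣ a ℚ.- xₙ ∣             ≡⟨ ∣p-q∣≡∣q-p∣ a xₙ ⟩
  ℚ.∣ xₙ ℚ.- a ∣             <⟨ close n (ℕₚ.m≤n⊔m K L) ⟩
  g                          ∎)
  where
  open ℚₚ.≤-Reasoning
  n = K ℕ.⊔ L
  xₙ = seq x n

≃⇒≥ : ∀ {x a b} → x ≃ fromℚ a → b ℚ.≤ a → fromℚ b ≤ x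
≃⇒≥ {x} x≃a b≤a x<b = ≃⇒≮ {x} x≃a (<-≤-fromℚ {x} x<b b≤a)

≃⇒< : ∀ {x a b} → x ≃ fromℚ a → a ℚ.< b → x < fromℚ b
≃⇒< {x} {a} {b} x≃a a<b with x≃a (½ ℚ.* (b ℚ.- a)) 0<g
  where
  0<g = 0<p*q 0<½ (subst (ℚ._< b ℚ.- a) (ℚₚ.+-inverseʳ a) (ℚₚ.+-monoˡ-< (ℚ.- a) a<b))
... | K , close = mk< g 0<g K λ n K≤n → begin-strict
  seq x n ℚ.+ g                        ≡⟨ S.solve 3 (λ x a g → x S.:+ g S.:= (x S.:- a) S.:+ (a S.:+ g)) refl (seq x n) a g ⟩
  (seq x n ℚ.- a) ℚ.+ (a ℚ.+ g)        ≤⟨ ℚₚ.+-monoˡ-≤ (a ℚ.+ g) (p≤∣p∣ (seq x n ℚ.- a)) ⟩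
  ℚ.∣ seq x n ℚ.- a ∣ ℚ.+ (a ℚ.+ g)    <⟨ ℚₚ.+-monoˡ-< (a ℚ.+ g) (close n K≤n) ⟩
  g ℚ.+ (a ℚ.+ g)                      ≡⟨ S.solve 2 (λ a b → S.con ½ S.:* (b S.:- a) S.:+ (a S.:+ S.con ½ S.:* (b S.:- a)) S.:= b) refl a b ⟩
  b                                    ∎
  where
  open ℚₚ.≤-Reasoning
  g = ½ ℚ.* (b ℚ.- a)
  0<g = 0<p*q 0<½ (subst (ℚ._< b ℚ.- a) (ℚₚ.+-inverseʳ a) (ℚₚ.+-monoˡ-< (ℚ.- a) a<b))

seq≤⇒≤ : ∀ {x y} → (∀ n → seq x n ℚ.≤ seq y n) → x ≤ y
seq≤⇒≤ {x} {y} x≤y (mk< g 0<g K sep) = ℚₚ.<-irrefl refl (begin-strict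
  seq y K           ≡⟨ ℚₚ.+-identityʳ (seq y K) ⟨
  seq y K ℚ.+ 0ℚ    <⟨ ℚₚ.+-monoʳ-< (seq y K) 0<g ⟩
  seq y K ℚ.+ g     <⟨ sep K ℕₚ.≤-refl ⟩
  seq x K           ≤⟨ x≤y K ⟩
  seq y K           ∎)
  where open ℚₚ.≤-Reasoning

seq≤-≤-trans : ∀ {x y z} → (∀ n → seq x n ℚ.≤ seq y n) → y ≤ z → x ≤ z
seq≤-≤-trans x≤y y≤z (mk< g 0<g K sep) = y≤z (mk< g 0<g K λ n K≤n → ℚₚ.<-≤-trans (sep n K≤n) (x≤y n))

-- Since order against a rational is undecidable, the search succeeds only up to double negation.
locate : ∀ (q : ℕ → ℚ) x s → fromℚ (q 0) ≤ x → x < fromℚ (q s) →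
         ¬ ¬ (∃[ i ] i ℕ.< s × fromℚ (q i) ≤ x × x < fromℚ (q (suc i)))
locate q x zero    q₀≤x x<qₛ none = q₀≤x x<qₛ
locate q x (suc s) q₀≤x x<qₛ none = none (s , ℕₚ.≤-refl ,
  (λ x<q → locate q x s q₀≤x x<q λ (i , i<s , h) → none (i , ℕₚ.m<n⇒m<1+n i<s , h)) , x<qₛ)

-- Counting points by enclosing lists.

unique⇒lookup-injective : ∀ {A : Set} {xs : List A} → Unique xs → ∀ i j → lookup xs i ≡ lookup xs j → i ≡ j
unique⇒lookup-injective (x∉ ∷ u) Fin.zero    Fin.zero    eq = refl
unique⇒lookup-injective (x∉ ∷ u) Fin.zero    (Fin.suc j) eq = contradiction eq (All.lookup x∉ (∈-lookup j))
unique⇒lookup-injective (x∉ ∷ u) (Fin.suc i) Fin.zero    eq = contradiction (sym eq) (All.lookup x∉ (∈-lookup i))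
unique⇒lookup-injective (x∉ ∷ u) (Fin.suc i) (Fin.suc j) eq = cong Fin.suc (unique⇒lookup-injective u i j eq)

-- Pigeonhole: sending a position in `xs` to the position of the same element in `ys` is injective.
unique-⊆⇒length≤ : ∀ {A : Set} {xs ys : List A} → Unique xs → (∀ {z} → z ∈ xs → z ∈ ys) → length xs ℕ.≤ length ys
unique-⊆⇒length≤ {xs = xs} {ys} u sub = Finₚ.injective⇒≤ {f = λ i → index (at i)} λ {i} {j} eq →
  unique⇒lookup-injective u i j
    (trans (Anyₚ.lookup-index (at i)) (trans (cong (lookup ys) eq) (sym (Anyₚ.lookup-index (at j)))))
  where
  at : ∀ i → lookup xs i ∈ ys
  at i = sub (∈-lookup i)

-- An explicit list squeezed between `Q` and `R` replaces a cardinality, since neither predicate is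
-- decidable beforehand. Repetitions are allowed, so `c` bounds the number of elements from above.
Between : ∀ {A : Set} → Pred A 0ℓ → Pred A 0ℓ → ℕ → Set
Between {A} Q R c = Σ[ ps ∈ List A ] length ps ≡ c × All R ps × (∀ {n} → Q n → n ∈ ps)

between-⋃ : ∀ {A : Set} {Q : ℕ → Pred A 0ℓ} {R} f s → (∀ i → i ℕ.< s → Between (Q i) R (f i)) →
            Between (λ n → ∃[ i ] i ℕ.< s × Q i n) R (sumℕ s f)
between-⋃ f zero    h = [] , refl , [] , λ ()
between-⋃ {Q = Q} f (suc s) h with between-⋃ {Q = Q} f s (λ i i<s → h i (ℕₚ.m<n⇒m<1+n i<s)) | h s ℕₚ.≤-refl
... | ps , |ps| , allps , ps⊇ | qs , |qs| , allqs , qs⊇ =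
  ps ++ qs , trans (Listₚ.length-++ ps) (cong₂ ℕ._+_ |ps| |qs|) , Allₚ.++⁺ allps allqs , includes
  where
  includes : ∀ {n} → ∃[ i ] i ℕ.< suc s × Q i n → n ∈ ps ++ qs
  includes (i , i<1+s , Qin) with ℕₚ.m≤n⇒m<n∨m≡n (ℕₚ.≤-pred i<1+s)
  ... | inj₁ i<s  = ∈-++⁺ˡ (ps⊇ (i , i<s , Qin))
  ... | inj₂ refl = ∈-++⁺ʳ ps (qs⊇ Qin)

-- Membership in the list decides `R`: listed elements satisfy `R`, and an unlisted one cannot
-- satisfy `Q`, which `R` implies up to double negation.
between⇒decidable : ∀ {N c} {Q R : Pred (Fin N) 0ℓ} → Between Q R c → (∀ n → R n → ¬ ¬ Q n) → Decidable R
between⇒decidable (ps , _ , all , ps⊇) R⇒Q n with _∈?_ Finₚ._≟_ n ps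
... | yes n∈ps = yes (All.lookup all n∈ps)
... | no  n∉ps = no λ Rn → R⇒Q n Rn (n∉ps ∘ ps⊇)

-- List membership is decidable, hence stable, so the double negation on `Q` does no harm:
-- everything that passes the filter is in the list.
between⇒count≤ : ∀ {N c} {Q R : Pred (Fin N) 0ℓ} → Between Q R c → (∀ n → R n → ¬ ¬ Q n) →
                 (R? : Decidable R) → length (filter R? (allFin N)) ℕ.≤ c
between⇒count≤ {N} (ps , refl , _ , ps⊇) R⇒Q R? = unique-⊆⇒length≤ (Uniqueₚ.filter⁺ R? (Uniqueₚ.allFin⁺ N)) λ {z} z∈ →
  decidable-stable (_∈?_ Finₚ._≟_ z ps) λ z∉ps → R⇒Q z (proj₂ (∈-filter⁻ R? {xs = allFin N} z∈)) (z∉ps ∘ ps⊇)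

exactlyOne : ∀ {N} {P : Pred (Fin N) 0ℓ} → HoldsForExactly 1 P → ∃[ p ] P p × (∀ n → P n → n ≡ p)
exactlyOne {N} (P? , eq) with filter P? (allFin N) in filter≡ | eq
... | p ∷ [] | refl = p
  , proj₂ (∈-filter⁻ P? {xs = allFin N} (subst (p ∈_) (sym filter≡) (here refl)))
  , λ n Pn → ∈[p]⇒≡ (subst (n ∈_) filter≡ (∈-filter⁺ P? (∈-allFin n) Pn))
  where
  ∈[p]⇒≡ : ∀ {n} → n ∈ p ∷ [] → n ≡ p
  ∈[p]⇒≡ (here n≡p) = n≡p

-- The discrepancy function as a count.

χ≡ι : ∀ {A : Set} {P : Pred A 0ℓ} (P? : Decidable P) a as i →
      seq (χ (P? a)) i ℚ.+ ι (length (filter P? as)) ≡ ι (length (filter P? (a ∷ as)))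
χ≡ι P? a as i with does (P? a)
... | true  = trans (ℚₚ.+-comm 1ℚ (ι (length (filter P? as)))) (sym (suc/1 (length (filter P? as))))
... | false = ℚₚ.+-identityˡ (ι (length (filter P? as)))

-- Stated for an arbitrary `f` because the induction on `N` replaces `f` by its tail. The equality
-- is exact at each index of the approximating sequence, so later estimates are purely rational.
seq-sum-χ : ∀ {N} {A : Set} {P : Pred A 0ℓ} (P? : Decidable P) (f : Fin N → A) c i →
            seq (sum λ n → χ (P? (f n)) - c) i ≡ ι (length (filter P? (tabulate f))) ℚ.- ι N ℚ.* seq c i
seq-sum-χ {zero}  P? f c i = sym (cong (λ z → 0ℚ ℚ.- z) (ℚₚ.*-zeroˡ (seq c i)))
seq-sum-χ {suc N} P? f c i = begin
  (e ℚ.- cᵢ) ℚ.+ seq (sum λ n → χ (P? (f (Fin.suc n))) - c) i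
    ≡⟨ cong ((e ℚ.- cᵢ) ℚ.+_) (seq-sum-χ P? (f ∘ Fin.suc) c i) ⟩
  (e ℚ.- cᵢ) ℚ.+ (l ℚ.- ι N ℚ.* cᵢ)
    ≡⟨ S.solve 4 (λ e l n c → (e S.:- c) S.:+ (l S.:- n S.:* c) S.:= (e S.:+ l) S.:- (n S.:+ S.con 1ℚ) S.:* c) refl e l (ι N) cᵢ ⟩
  (e ℚ.+ l) ℚ.- (ι N ℚ.+ 1ℚ) ℚ.* cᵢ
    ≡⟨ cong₂ (λ y z → y ℚ.- z ℚ.* cᵢ) (χ≡ι P? (f Fin.zero) (tabulate (f ∘ Fin.suc)) i) (sym (suc/1 N)) ⟩
  ι (length (filter P? (tabulate f))) ℚ.- ι (suc N) ℚ.* cᵢ ∎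
  where
  open ≡-Reasoning
  e = seq (χ (P? (f Fin.zero))) i
  l = ι (length (filter P? (tabulate (f ∘ Fin.suc))))
  cᵢ = seq c i

-- The logarithm of a power of two.

-- ∫₁^{2q} splits at 2, and substituting t = 2u turns the second part into ∫₁^q with half the mesh.
logSum-double : ∀ q .{{_ : NonZero q}} n → logSum (2 ℕ.* q) n ℚ.≤ logSum 2 n ℚ.+ logSum q n
logSum-double q@(suc p) n = begin
  logSum (2 ℕ.* q) n
    ≡⟨ cong (λ z → sumℚ z (λ j → recip (n ℕ.+ j))) (terms p n) ⟩
  sumℚ (1 ℕ.* suc n ℕ.+ p ℕ.* suc n′) (λ j → recip (n ℕ.+ j))
    ≡⟨ sum-+ (1 ℕ.* suc n) (p ℕ.* suc n′) (λ j → recip (n ℕ.+ j)) ⟩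
  logSum 2 n ℚ.+ sumℚ (p ℕ.* suc n′) (λ j → recip (n ℕ.+ (1 ℕ.* suc n ℕ.+ j)))
    ≤⟨ ℚₚ.+-monoʳ-≤ (logSum 2 n) (sum-mono (p ℕ.* suc n′) λ j _ → ℚₚ.≤-reflexive (cong recip (idx n j))) ⟩
  logSum 2 n ℚ.+ logSum q n′
    ≤⟨ ℚₚ.+-monoʳ-≤ (logSum 2 n) (Refine.upper q n 1) ⟩
  logSum 2 n ℚ.+ logSum q n ∎
  where
  open ℚₚ.≤-Reasoning
  n′ = 1 ℕ.+ n ℕ.* 2
  terms : ∀ p n → (p ℕ.+ suc (p ℕ.+ 0)) ℕ.* suc n ≡ 1 ℕ.* suc n ℕ.+ p ℕ.* suc (1 ℕ.+ n ℕ.* 2)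
  terms = solve-∀
  idx : ∀ n j → n ℕ.+ (1 ℕ.* suc n ℕ.+ j) ≡ 1 ℕ.+ n ℕ.* 2 ℕ.+ j
  idx = solve-∀

-- Repeated doubling. Refining the mesh can only lower a left Riemann sum of the decreasing 1/t, so
-- at a fixed mesh the result is an inequality.
logSum-2^ : ∀ d n → logSum (2 ℕ.^ d) n ℚ.≤ ι d ℚ.* logSum 2 n
logSum-2^ zero    n = ℚₚ.≤-reflexive (sym (ℚₚ.*-zeroˡ (logSum 2 n)))
logSum-2^ (suc d) n = begin
  logSum (2 ℕ.^ suc d) n                   ≤⟨ logSum-double (2 ℕ.^ d) {{^-nonZero 2 d}} n ⟩
  logSum 2 n ℚ.+ logSum (2 ℕ.^ d) n        ≤⟨ ℚₚ.+-monoʳ-≤ (logSum 2 n) (logSum-2^ d n) ⟩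
  logSum 2 n ℚ.+ ι d ℚ.* logSum 2 n        ≡⟨ S.solve 2 (λ d l → l S.:+ d S.:* l S.:= (d S.:+ S.con 1ℚ) S.:* l) refl (ι d) (logSum 2 n) ⟩
  (ι d ℚ.+ 1ℚ) ℚ.* logSum 2 n              ≡⟨ cong (ℚ._* logSum 2 n) (suc/1 d) ⟨
  ι (suc d) ℚ.* logSum 2 n                 ∎
  where open ℚₚ.≤-Reasoning

-- Elementary intervals in the unit square.

-- A planar elementary interval with plain natural numbers as corner indices, so that the index
-- bounds are needed only where the net property is invoked.
InCell : ℕ → ℕ → ℕ → ℕ → Point 2 → Set
InCell d₁ d₂ u v y =
  (fromℚ (dyadic u d₁) ≤ y Fin.zero × y Fin.zero < fromℚ (dyadic (suc u) d₁)) ×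
  (fromℚ (dyadic v d₂) ≤ y (Fin.suc Fin.zero) × y (Fin.suc Fin.zero) < fromℚ (dyadic (suc v) d₂))

module _ (d₁ d₂ : ℕ) where

  private
    d : Vector.Vector ℕ 2
    d = d₁ Vector.∷ d₂ Vector.∷ Vector.[]

  volume₂ : volume 2 d ≡ 2 ^- (d₁ ℕ.+ d₂)
  volume₂ = trans (cong (2 ^- d₁ ℚ.*_) (ℚₚ.*-identityʳ (2 ^- d₂))) (sym (2^-distrib-+ d₁ d₂))

  module _ {u v} (u<2^d₁ : u ℕ.< 2 ℕ.^ d₁) (v<2^d₂ : v ℕ.< 2 ℕ.^ d₂) where

    corners : (i : Fin 2) → Fin (2 ℕ.^ d i)
    corners Fin.zero           = fromℕ< u<2^d₁
    corners (Fin.suc Fin.zero) = fromℕ< v<2^d₂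

    private
      InSide : ℕ → ℕ → ℝ → Set
      InSide d u y = fromℚ (dyadic u d) ≤ y × y < fromℚ (dyadic (suc u) d)

    elementaryInterval⇒InCell : ∀ {y} → _∈elementaryInterval_ 2 d y corners → InCell d₁ d₂ u v y
    elementaryInterval⇒InCell {y} h =
      subst (λ w → InSide d₁ w (y Fin.zero)) (Finₚ.toℕ-fromℕ< u<2^d₁) (h Fin.zero) ,
      subst (λ w → InSide d₂ w (y (Fin.suc Fin.zero))) (Finₚ.toℕ-fromℕ< v<2^d₂) (h (Fin.suc Fin.zero))

    InCell⇒elementaryInterval : ∀ {y} → InCell d₁ d₂ u v y → _∈elementaryInterval_ 2 d y corners
    InCell⇒elementaryInterval {y} (h₁ , h₂) Fin.zero           = subst (λ w → InSide d₁ w (y Fin.zero)) (sym (Finₚ.toℕ-fromℕ< u<2^d₁)) h₁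
    InCell⇒elementaryInterval {y} (h₁ , h₂) (Fin.suc Fin.zero) = subst (λ w → InSide d₂ w (y (Fin.suc Fin.zero))) (sym (Finₚ.toℕ-fromℕ< v<2^d₂)) h₂

    -- As t = 0, an elementary interval of volume 2^-m holds exactly 2⁰ = 1 net point.
    cellPoint : ∀ {m x} → IsNet 0 m 2 2 x → d₁ ℕ.+ d₂ ≡ m →
                ∃[ p ] InCell d₁ d₂ u v (x p) × (∀ n → InCell d₁ d₂ u v (x n) → n ≡ p)
    cellPoint {m} {x} net d₁+d₂≡m =
      let p , inside , unique = exactlyOne {P = λ n → _∈elementaryInterval_ 2 d (x n) corners}
            (IsNet.equidistributed net d corners (trans volume₂ (cong (2 ^-_) d₁+d₂≡m)))
      in p , elementaryInterval⇒InCell {x p} inside , λ n h → unique n (InCell⇒elementaryInterval {x n} h)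

-- The corner γ in closed form.

dyadic-zero : ∀ d → dyadic 0 d ≡ 0ℚ
dyadic-zero d = ℚₚ.*-zeroˡ (2 ^- d)

dyadic-double : ∀ u d → dyadic (2 ℕ.* u) (suc d) ≡ dyadic u d
dyadic-double u d = sym (trans (dyadic-scale u d 1) (cong₂ dyadic (ℕₚ.*-comm u 2) (ℕₚ.+-comm d 1)))

dyadic-quadruple : ∀ u j → dyadic (4 ℕ.* u) (2 ℕ.* suc j) ≡ dyadic u (2 ℕ.* j)
dyadic-quadruple u j = sym (trans (dyadic-scale u (2 ℕ.* j) 2) (cong₂ dyadic (ℕₚ.*-comm u 4) (eq j)))
  where
  eq : ∀ j → 2 ℕ.* j ℕ.+ 2 ≡ 2 ℕ.* suc j
  eq = solve-∀

2*repunit<2^ : ∀ c r → 2 ℕ.* repunit r ℕ.< 2 ℕ.^ suc (c ℕ.+ 2 ℕ.* r)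
2*repunit<2^ c r = ℕₚ.*-monoʳ-< 2 (ℕₚ.<-≤-trans (repunit<2^ r) (ℕₚ.^-monoʳ-≤ 2 (ℕₚ.m≤n+m (2 ℕ.* r) c)))

-- γ for m = 4k, with the finite sums evaluated and the divisions m/4 and m/2 carried out.
corner : ℕ → Point 2
corner k = fromℚ (dyadic (repunit k) (2 ℕ.* k)) Vector.∷ fromℚ (dyadic (repunit k) (2 ℕ.* k ℕ.+ 2 ℕ.* k)) Vector.∷ Vector.[]

γ≡corner : ∀ k → γ (k ℕ.* 4) ≡ corner k
γ≡corner k = cong₂ (λ p q → fromℚ p Vector.∷ fromℚ q Vector.∷ Vector.[]) (γ₁-dyadic k) (γ₂-dyadic k)

dyadic-repunit∈unitInterval : ∀ k d → 2 ℕ.* k ℕ.≤ d → 0ℝ ≤ fromℚ (dyadic (repunit k) d) × fromℚ (dyadic (repunit k) d) < 1ℝ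
dyadic-repunit∈unitInterval k d 2k≤d =
  ≃⇒≥ {y} (≃-refl {y}) (subst (ℚ._≤ q) (dyadic-zero d) (dyadic-monoˡ-≤ d {0} {repunit k} z≤n)) ,
  ≃⇒< {y} (≃-refl {y}) (subst (q ℚ.<_) (2^*2^- d) (dyadic-monoˡ-< d {repunit k} {2 ℕ.^ d}
    (ℕₚ.<-≤-trans (repunit<2^ k) (ℕₚ.^-monoʳ-≤ 2 2k≤d))))
  where
  q = dyadic (repunit k) d
  y = fromℚ q

corner∈unitSquare : ∀ k i → 0ℝ ≤ corner k i × corner k i < 1ℝ
corner∈unitSquare k Fin.zero           = dyadic-repunit∈unitInterval k (2 ℕ.* k) ℕₚ.≤-refl
corner∈unitSquare k (Fin.suc Fin.zero) = dyadic-repunit∈unitInterval k (2 ℕ.* k ℕ.+ 2 ℕ.* k) (ℕₚ.m≤m+n (2 ℕ.* k) (2 ℕ.* k))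

-- Covering the points of J_γ by cells.

module Geometry (k : ℕ) {x : Fin (2 ℕ.^ (k ℕ.* 4)) → Point 2} (net : IsNet 0 (k ℕ.* 4) 2 2 x)
  (x₀≃γ : ∀ i → x (first (k ℕ.* 4)) i ≃ corner k i) where

  private
    N = 2 ℕ.^ (k ℕ.* 4)
    o = first (k ℕ.* 4)
    x₁ x₂ : Fin N → ℝ
    x₁ n = x n Fin.zero
    x₂ n = x n (Fin.suc Fin.zero)

    x₀≃γ₁ = x₀≃γ Fin.zero
    x₀≃γ₂ = x₀≃γ (Fin.suc Fin.zero)

    trunc₁ trunc₂ : ℕ → ℚ
    trunc₁ j = dyadic (repunit j) (2 ℕ.* j)
    trunc₂ r = dyadic (repunit r) (2 ℕ.* k ℕ.+ 2 ℕ.* r)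

  J : Pred (Fin N) 0ℓ
  J n = x n ∈[0, corner k ⟩

  -- Row `β` of column `j`: since `repunit (suc j)` is 4 · `repunit j` + 1, the horizontal side runs
  -- from `trunc₁ j` to `trunc₁ (suc j)`. For r = k - j - 1 the volume is 2^-(4k) = 1/N.
  Cell : ℕ → ℕ → ℕ → Pred (Fin N) 0ℓ
  Cell j r β n = InCell (2 ℕ.* suc j) (2 ℕ.* k ℕ.+ 2 ℕ.* r) (4 ℕ.* repunit j) β (x n)

  -- The right edge is a truncation of γ⁽¹⁾ with j + 1 ≤ k digits, and the top edge is at most the
  -- truncation of γ⁽²⁾ with r ≤ k digits.
  cell⊆J : ∀ j r β → j ℕ.+ suc r ≡ k → β ℕ.< repunit r → ∀ n → Cell j r β n → J n
  cell⊆J j r β refl β<rep n ((_ , x₁<) , _) Fin.zero =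
    proj₁ (IsNet.inUnitCube net n Fin.zero) ,
    <-≤-fromℚ {x₁ n} x₁< (truncation-mono 0 (ℕₚ.≤-trans (ℕₚ.m≤m+n (suc j) r) (ℕₚ.≤-reflexive (sym (ℕₚ.+-suc j r)))))
  cell⊆J j r β refl β<rep n (_ , (_ , x₂<)) (Fin.suc Fin.zero) =
    proj₁ (IsNet.inUnitCube net n (Fin.suc Fin.zero)) ,
    <-≤-fromℚ {x₂ n} x₂< (ℚₚ.≤-trans (dyadic-monoˡ-≤ (2 ℕ.* k ℕ.+ 2 ℕ.* r) β<rep)
      (truncation-mono (2 ℕ.* k) (ℕₚ.≤-trans (ℕₚ.n≤1+n r) (ℕₚ.m≤n+m (suc r) j))))

  cellBetween : ∀ j r β → j ℕ.+ suc r ≡ k → β ℕ.< repunit r → Between (Cell j r β) J 1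
  cellBetween j r β j+1+r≡k β<rep =
    let p , inside , unique = cellPoint (2 ℕ.* suc j) (2 ℕ.* k ℕ.+ 2 ℕ.* r) {4 ℕ.* repunit j} {β} u< β< {x = x} net sum≡
    in p ∷ [] , refl , cell⊆J j r β j+1+r≡k β<rep p inside ∷ [] , λ {n} h → here (unique n h)
    where
    eq : ∀ j r → let k = j ℕ.+ suc r in 2 ℕ.* suc j ℕ.+ (2 ℕ.* k ℕ.+ 2 ℕ.* r) ≡ k ℕ.* 4
    eq = solve-∀
    sum≡ : 2 ℕ.* suc j ℕ.+ (2 ℕ.* k ℕ.+ 2 ℕ.* r) ≡ k ℕ.* 4
    sum≡ = subst (λ k → 2 ℕ.* suc j ℕ.+ (2 ℕ.* k ℕ.+ 2 ℕ.* r) ≡ k ℕ.* 4) j+1+r≡k (eq j r)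
    u< : 4 ℕ.* repunit j ℕ.< 2 ℕ.^ (2 ℕ.* suc j)
    -- The successor of 4 · `repunit j` is by definition `repunit (suc j)`.
    u< = ℕₚ.<-trans (ℕₚ.n<1+n _) (repunit<2^ (suc j))
    β< : β ℕ.< 2 ℕ.^ (2 ℕ.* k ℕ.+ 2 ℕ.* r)
    β< = ℕₚ.<-trans β<rep (ℕₚ.<-≤-trans (repunit<2^ r) (ℕₚ.^-monoʳ-≤ 2 (ℕₚ.m≤n+m (2 ℕ.* r) (2 ℕ.* k))))

  -- Columns are indexed by r, with j = k - r - 1, so that the number of cells is literally
  -- `sumℕ k repunit`.
  Cells : Pred (Fin N) 0ℓ
  Cells n = ∃[ r ] r ℕ.< k × ∃[ β ] β ℕ.< repunit r × Cell (k ℕ.∸ suc r) r β n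

  cellsBetween : Between Cells J (sumℕ k repunit)
  cellsBetween = between-⋃ repunit k λ r r<k → subst (Between _ J) (sumℕ-1 (repunit r))
    (between-⋃ (λ _ → 1) (repunit r) λ β β<rep → cellBetween (k ℕ.∸ suc r) r β (ℕₚ.m∸n+n≡m r<k) β<rep)

  -- In the j-th column, the part of J above the cells shares with γ an elementary interval of
  -- volume 1/N, which therefore has no room for a second point.
  column : ∀ j r → j ℕ.+ suc r ≡ k → ∀ n → J n → fromℚ (trunc₁ j) ≤ x₁ n → x₁ n < fromℚ (trunc₁ (suc j)) →
           ¬ ¬ (∃[ β ] β ℕ.< repunit r × Cell j r β n)
  column j r j+1+r≡k n Jn t₁≤x₁ x₁<t₁ none =
    -- The point must be x₀ itself, yet the first coordinate of x₀ is γ⁽¹⁾, which the half-open J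
    -- excludes.
    ≃⇒≮ {x₁ o} x₀≃γ₁ (subst (λ n → x₁ n < fromℚ (trunc₁ k)) n≡o (proj₂ (Jn Fin.zero)))
    where
    eq : ∀ j r → let k = j ℕ.+ suc r in suc (2 ℕ.* j) ℕ.+ suc (2 ℕ.* k ℕ.+ 2 ℕ.* r) ≡ k ℕ.* 4
    eq = solve-∀
    sum≡ : suc (2 ℕ.* j) ℕ.+ suc (2 ℕ.* k ℕ.+ 2 ℕ.* r) ≡ k ℕ.* 4
    sum≡ = subst (λ k → suc (2 ℕ.* j) ℕ.+ suc (2 ℕ.* k ℕ.+ 2 ℕ.* r) ≡ k ℕ.* 4) j+1+r≡k (eq j r)

    0≤x₂ = proj₁ (Jn (Fin.suc Fin.zero))
    x₂<γ₂ = proj₂ (Jn (Fin.suc Fin.zero))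

    -- Twice as wide and half as tall as a cell of this column, hence again of volume 1/N. Its lower
    -- left corner is (`trunc₁ j`, `trunc₂ r`), and by `truncation-<` it extends beyond γ in both
    -- directions.
    Block : Pred (Fin N) 0ℓ
    Block n = InCell (suc (2 ℕ.* j)) (suc (2 ℕ.* k ℕ.+ 2 ℕ.* r)) (2 ℕ.* repunit j) (2 ℕ.* repunit r) (x n)

    left₁ : dyadic (2 ℕ.* repunit j) (suc (2 ℕ.* j)) ≡ trunc₁ j
    left₁ = dyadic-double (repunit j) (2 ℕ.* j)

    left₂ : dyadic (2 ℕ.* repunit r) (suc (2 ℕ.* k ℕ.+ 2 ℕ.* r)) ≡ trunc₂ r
    left₂ = dyadic-double (repunit r) (2 ℕ.* k ℕ.+ 2 ℕ.* r)

    above : fromℚ (trunc₂ r) ≤ x₂ n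
    -- Being a negation, `≤` may be proved from a double-negated search: below `trunc₂ r` the point
    -- would lie in some row `β`, against `none`.
    above x₂<t₂ = locate (λ β → dyadic β (2 ℕ.* k ℕ.+ 2 ℕ.* r)) (x₂ n) (repunit r)
      (subst (λ q → fromℚ q ≤ x₂ n) (sym (dyadic-zero (2 ℕ.* k ℕ.+ 2 ℕ.* r))) 0≤x₂) x₂<t₂
      λ (β , β<rep , h) → none (β , β<rep ,
        (subst (λ q → fromℚ q ≤ x₁ n) (sym (dyadic-quadruple (repunit j) j)) t₁≤x₁ , x₁<t₁) , h)

    n∈Block : Block n
    n∈Block =
      (subst (λ q → fromℚ q ≤ x₁ n) (sym left₁) t₁≤x₁ , <-≤-fromℚ {x₁ n} x₁<t₁ (ℚₚ.<⇒≤ (truncation-< 0 (suc j) j))) ,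
      (subst (λ q → fromℚ q ≤ x₂ n) (sym left₂) above , <-≤-fromℚ {x₂ n} x₂<γ₂ (ℚₚ.<⇒≤ (truncation-< (2 ℕ.* k) k r)))

    j≤k : j ℕ.≤ k
    j≤k = subst (j ℕ.≤_) j+1+r≡k (ℕₚ.m≤m+n j (suc r))

    r≤k : r ℕ.≤ k
    r≤k = subst (r ℕ.≤_) j+1+r≡k (ℕₚ.≤-trans (ℕₚ.n≤1+n r) (ℕₚ.m≤n+m (suc r) j))

    o∈Block : Block o
    o∈Block =
      (≃⇒≥ {x₁ o} x₀≃γ₁ (subst (ℚ._≤ trunc₁ k) (sym left₁) (truncation-mono 0 j≤k)) ,
       ≃⇒< {x₁ o} x₀≃γ₁ (truncation-< 0 k j)) ,
      (≃⇒≥ {x₂ o} x₀≃γ₂ (subst (ℚ._≤ trunc₂ k) (sym left₂) (truncation-mono (2 ℕ.* k) r≤k)) ,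
       ≃⇒< {x₂ o} x₀≃γ₂ (truncation-< (2 ℕ.* k) k r))

    n≡o : n ≡ o
    n≡o =
      let _ , _ , unique = cellPoint (suc (2 ℕ.* j)) (suc (2 ℕ.* k ℕ.+ 2 ℕ.* r)) {2 ℕ.* repunit j} {2 ℕ.* repunit r}
            (2*repunit<2^ 0 j) (2*repunit<2^ (2 ℕ.* k) r) {x = x} net sum≡
      in trans (unique n n∈Block) (sym (unique o o∈Block))

  -- The truncations of γ⁽¹⁾ run from 0 to γ⁽¹⁾, so `locate` finds the column; `column` then finds
  -- the row. The rest converts the column index `j` into `r` and back.
  J⊆Cells : ∀ n → J n → ¬ ¬ Cells n
  J⊆Cells n Jn none = locate trunc₁ (x₁ n) k (proj₁ (Jn Fin.zero)) (proj₂ (Jn Fin.zero)) λ (j , j<k , t₁≤x₁ , x₁<t₁) →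
    let r = k ℕ.∸ suc j
        1+r≡k∸j : suc r ≡ k ℕ.∸ j
        1+r≡k∸j = sym (ℕₚ.+-∸-assoc 1 j<k)
        j≡ : k ℕ.∸ suc r ≡ j
        j≡ = trans (cong (k ℕ.∸_) 1+r≡k∸j) (ℕₚ.m∸[m∸n]≡n (ℕₚ.<⇒≤ j<k))
    in column j r (trans (cong (j ℕ.+_) 1+r≡k∸j) (ℕₚ.m+[n∸m]≡n (ℕₚ.<⇒≤ j<k))) n Jn t₁≤x₁ x₁<t₁
      λ (β , β<rep , h) → none (r , subst (ℕ._≤ k) (sym 1+r≡k∸j) (ℕₚ.m∸n≤m k j) , β , β<rep , subst (λ j → Cell j r β n) (sym j≡) h)

  J? : Decidable J
  J? = between⇒decidable cellsBetween J⊆Cells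


  count≤ : length (filter J? (allFin N)) ℕ.≤ sumℕ k repunit
  count≤ = between⇒count≤ cellsBetween J⊆Cells J?

-- From the count to the bound on Δ.

bound : ℕ → ℚ
bound m = (+ 1 / 4) ℚ.* 2 ^- (m ℕ.+ 2) ℚ.* (+ m / 1)

bound-4 : ∀ k → bound (k ℕ.* 4) ≡ 2 ^- (k ℕ.* 4) ℚ.* dyadic k 2
bound-4 k = begin
  (+ 1 / 4) ℚ.* 2 ^- (k ℕ.* 4 ℕ.+ 2) ℚ.* ι (k ℕ.* 4)
    ≡⟨ cong₂ (λ y z → (+ 1 / 4) ℚ.* y ℚ.* z) (2^-distrib-+ (k ℕ.* 4) 2) (ι-* k 4) ⟩
  (+ 1 / 4) ℚ.* (2 ^- (k ℕ.* 4) ℚ.* (+ 1 / 4)) ℚ.* (ι k ℚ.* ι 4)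
    ≡⟨ S.solve 2 (λ p i → S.con (+ 1 / 4) S.:* (p S.:* S.con (+ 1 / 4)) S.:* (i S.:* S.con (ι 4)) S.:= p S.:* (i S.:* S.con (+ 1 / 4)))
         refl (2 ^- (k ℕ.* 4)) (ι k) ⟩
  2 ^- (k ℕ.* 4) ℚ.* (ι k ℚ.* (+ 1 / 4)) ∎
  where open ≡-Reasoning

-- `deficit` divided by 4 · 4ᵏ: the actual count falls short of the expected count by at least k/4.
rational-deficit : ∀ k c → c ℕ.≤ sumℕ k repunit → ι c ℚ.+ dyadic k 2 ℚ.≤ dyadic (repunit k ℕ.* repunit k) (2 ℕ.* k)
rational-deficit k c c≤ = begin
  ι c ℚ.+ ι k ℚ.* (+ 1 / 4)
    ≡⟨ S.solve 2 (λ c k → c S.:+ k S.:* S.con (+ 1 / 4) S.:= (S.con (ι 4) S.:* c S.:+ k) S.:* S.con (+ 1 / 4)) refl (ι c) (ι k) ⟩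
  (ι 4 ℚ.* ι c ℚ.+ ι k) ℚ.* (+ 1 / 4)
    ≡⟨ cong (ℚ._* (+ 1 / 4)) (trans (ι-+ (4 ℕ.* c) k) (cong (ℚ._+ ι k) (ι-* 4 c))) ⟨
  dyadic (4 ℕ.* c ℕ.+ k) 2
    ≤⟨ dyadic-monoˡ-≤ 2 (ℕₚ.+-monoˡ-≤ k (ℕₚ.*-monoʳ-≤ 4 c≤)) ⟩
  dyadic (4 ℕ.* sumℕ k repunit ℕ.+ k) 2
    ≤⟨ dyadic-mono-≤ 0 (4 ℕ.* sumℕ k repunit ℕ.+ k) (repunit k ℕ.* repunit k) 2 (2 ℕ.* k) (deficit k) ⟩
  dyadic (repunit k ℕ.* repunit k) (2 ℕ.* k) ∎
  where open ℚₚ.≤-Reasoning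

-- N = 2^(4k) cancels the denominator of γ⁽²⁾; only the denominator 4ᵏ of γ⁽¹⁾ is left under the
-- squared repunit.
expected-count : ∀ k n → ι (2 ℕ.^ (k ℕ.* 4)) ℚ.* seq (product (corner k)) n ≡ dyadic (repunit k ℕ.* repunit k) (2 ℕ.* k)
expected-count k n = begin
  ι N ℚ.* (dyadic a d ℚ.* (dyadic a (d ℕ.+ d) ℚ.* 1ℚ))
    ≡⟨ cong (λ z → ι N ℚ.* (dyadic a d ℚ.* z)) (ℚₚ.*-identityʳ (dyadic a (d ℕ.+ d))) ⟩
  ι N ℚ.* (dyadic a d ℚ.* dyadic a (d ℕ.+ d))
    ≡⟨ cong (ι N ℚ.*_) (dyadic-* a a d (d ℕ.+ d)) ⟨
  ι N ℚ.* (ι (a ℕ.* a) ℚ.* 2 ^- (d ℕ.+ (d ℕ.+ d)))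
    ≡⟨ cong (λ z → ι N ℚ.* (ι (a ℕ.* a) ℚ.* z)) (trans (2^-distrib-+ d (d ℕ.+ d)) (cong (λ z → 2 ^- d ℚ.* 2 ^- z) (eq k))) ⟩
  ι N ℚ.* (ι (a ℕ.* a) ℚ.* (2 ^- d ℚ.* 2 ^- (k ℕ.* 4)))
    ≡⟨ S.solve 4 (λ N a p q → N S.:* (a S.:* (p S.:* q)) S.:= a S.:* p S.:* (N S.:* q)) refl (ι N) (ι (a ℕ.* a)) (2 ^- d) (2 ^- (k ℕ.* 4)) ⟩
  dyadic (a ℕ.* a) d ℚ.* (ι N ℚ.* 2 ^- (k ℕ.* 4))
    ≡⟨ cong (dyadic (a ℕ.* a) d ℚ.*_) (2^*2^- (k ℕ.* 4)) ⟩
  dyadic (a ℕ.* a) d ℚ.* 1ℚ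
    ≡⟨ ℚₚ.*-identityʳ (dyadic (a ℕ.* a) d) ⟩
  dyadic (a ℕ.* a) d ∎
  where
  open ≡-Reasoning
  a = repunit k
  d = 2 ℕ.* k
  N = 2 ℕ.^ (k ℕ.* 4)
  eq : ∀ k → 2 ℕ.* k ℕ.+ 2 ℕ.* k ≡ k ℕ.* 4
  eq = solve-∀

seq-scaledΔ : ∀ {N s} q (y : Point s) (x : Fin N → Point s) (in? : ∀ n → Dec (x n ∈[0, y ⟩)) i →
  seq (fromℚ q * Δ y x in?) i ≡ q ℚ.* (ι (length (filter in? (allFin N))) ℚ.- ι N ℚ.* seq (product y) i)
seq-scaledΔ {N} q y x in? i = cong (q ℚ.*_) (seq-sum-χ {P = λ n → x n ∈[0, y ⟩} in? (λ n → n) (product y) i)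

Δ-corner≤ : ∀ k c → c ℕ.≤ sumℕ k repunit → ∀ i →
  2 ^- (k ℕ.* 4) ℚ.* (ι c ℚ.- ι (2 ℕ.^ (k ℕ.* 4)) ℚ.* seq (product (corner k)) i) ℚ.≤ ℚ.- bound (k ℕ.* 4)
Δ-corner≤ k c c≤ i = begin
  P ℚ.* (ι c ℚ.- ι (2 ℕ.^ (k ℕ.* 4)) ℚ.* seq (product (corner k)) i)
    ≡⟨ cong (λ z → P ℚ.* (ι c ℚ.- z)) (expected-count k i) ⟩
  P ℚ.* (ι c ℚ.- e)
    ≤⟨ ℚₚ.*-monoˡ-≤-nonNeg P {{ℚ.nonNegative (ℚₚ.<⇒≤ (0<2^- (k ℕ.* 4)))}}
         (ℚₚ.+-monoʳ-≤ (ι c) (ℚₚ.neg-antimono-≤ (rational-deficit k c c≤))) ⟩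
  P ℚ.* (ι c ℚ.- (ι c ℚ.+ dyadic k 2))
    ≡⟨ S.solve 3 (λ P c d → P S.:* (c S.:- (c S.:+ d)) S.:= S.:- (P S.:* d)) refl P (ι c) (dyadic k 2) ⟩
  ℚ.- (P ℚ.* dyadic k 2)
    ≡⟨ cong ℚ.-_ (bound-4 k) ⟨
  ℚ.- bound (k ℕ.* 4) ∎
  where
  open ℚₚ.≤-Reasoning
  P = 2 ^- (k ℕ.* 4)
  e = dyadic (repunit k ℕ.* repunit k) (2 ℕ.* k)

-- The inequality is kept at every index of the sequence instead of as `≤` on reals: in this form it
-- yields both the bound on Δ and, after taking absolute values, the bound on D*.
SmallΔ : ∀ {N} .{{_ : NonZero N}} → (Fin N → Point 2) → Point 2 → ℚ → Set
SmallΔ x y b = Σ[ in? ∈ (∀ n → Dec (x n ∈[0, y ⟩)) ] (∀ i → seq (normalizedΔ y x in?) i ℚ.≤ ℚ.- b)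

corner-smallΔ : ∀ k {x} → IsNet 0 (k ℕ.* 4) 2 2 x → (∀ i → x (first (k ℕ.* 4)) i ≃ corner k i) →
  let instance N≢0 = ^-nonZero 2 (k ℕ.* 4) in SmallΔ x (corner k) (bound (k ℕ.* 4))
corner-smallΔ k {x} net x₀≃γ = J? , λ i →
  subst (ℚ._≤ ℚ.- bound (k ℕ.* 4)) (sym (seq-scaledΔ (2 ^- (k ℕ.* 4)) (corner k) x J? i))
    (Δ-corner≤ k (length (filter J? (allFin (2 ℕ.^ (k ℕ.* 4))))) count≤ i)
  where open Geometry k {x} net x₀≃γ

γ-smallΔ : ∀ k {x} → IsNet 0 (k ℕ.* 4) 2 2 x → (∀ i → x (first (k ℕ.* 4)) i ≃ γ (k ℕ.* 4) i) →
  let instance N≢0 = ^-nonZero 2 (k ℕ.* 4) in SmallΔ x (γ (k ℕ.* 4)) (bound (k ℕ.* 4))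
γ-smallΔ k {x} net x₀≃γ =
  let instance N≢0 = ^-nonZero 2 (k ℕ.* 4) in
  subst (λ y → SmallΔ x y (bound (k ℕ.* 4))) (sym (γ≡corner k))
    (corner-smallΔ k {x} net (subst (λ y → ∀ i → x (first (k ℕ.* 4)) i ≃ y i) (γ≡corner k) x₀≃γ))

γ∈unitSquare : ∀ k i → 0ℝ ≤ γ (k ℕ.* 4) i × γ (k ℕ.* 4) i < 1ℝ
γ∈unitSquare k = subst (λ y → ∀ i → 0ℝ ≤ y i × y i < 1ℝ) (sym (γ≡corner k)) (corner∈unitSquare k)

-- The logarithmic form and the star-discrepancy.

-- At each mesh log N ≤ m log 2, so the left side is at most m log 2 / (16 N log 2) = m / (16 N).
-- Cancelling log 2 is legitimate because its Riemann sums are at least ½.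
log-bound : ∀ m n → (1ℚ ℚ.* invℚ (ι 16 ℚ.* logSum 2 n)) ℚ.* (logSum (2 ℕ.^ m) n ℚ.* invℚ (ι (2 ℕ.^ m))) ℚ.≤ bound m
log-bound m n = begin
  (1ℚ ℚ.* U) ℚ.* (logSum (2 ℕ.^ m) n ℚ.* I)
    ≡⟨ S.solve 3 (λ U M I → (S.con 1ℚ S.:* U) S.:* (M S.:* I) S.:= (U S.:* I) S.:* M) refl U (logSum (2 ℕ.^ m) n) I ⟩
  (U ℚ.* I) ℚ.* logSum (2 ℕ.^ m) n
    ≤⟨ ℚₚ.*-monoˡ-≤-nonNeg (U ℚ.* I) {{ℚ.nonNegative (ℚₚ.<⇒≤ (0<p*q (0<invℚ 0<16L) (0<invℚ 0<N)))}} (logSum-2^ m n) ⟩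
  (U ℚ.* I) ℚ.* (ι m ℚ.* L)
    ≡⟨ S.solve 4 (λ U I m L → (U S.:* I) S.:* (m S.:* L) S.:= (U S.:* (S.con (ι 16) S.:* L)) S.:* (S.con (+ 1 / 4) S.:* (I S.:* S.con (+ 1 / 4)) S.:* m)) refl U I (ι m) L ⟩
  (U ℚ.* (ι 16 ℚ.* L)) ℚ.* ((+ 1 / 4) ℚ.* (I ℚ.* (+ 1 / 4)) ℚ.* ι m)
    ≡⟨ cong₂ (λ y z → y ℚ.* ((+ 1 / 4) ℚ.* (z ℚ.* (+ 1 / 4)) ℚ.* ι m)) (invℚ-*ˡ 0<16L) I≡ ⟩
  1ℚ ℚ.* ((+ 1 / 4) ℚ.* (2 ^- m ℚ.* 2 ^- 2) ℚ.* ι m)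
    ≡⟨ ℚₚ.*-identityˡ _ ⟩
  (+ 1 / 4) ℚ.* (2 ^- m ℚ.* 2 ^- 2) ℚ.* ι m
    ≡⟨ cong (λ z → (+ 1 / 4) ℚ.* z ℚ.* ι m) (2^-distrib-+ m 2) ⟨
  bound m ∎
  where
  open ℚₚ.≤-Reasoning
  L = logSum 2 n
  U = invℚ (ι 16 ℚ.* L)
  I = invℚ (ι (2 ℕ.^ m))
  0<16L : 0ℚ ℚ.< ι 16 ℚ.* L
  0<16L = 0<p*q {ι 16} {L} (ι-mono-< {0} {16} (s≤s z≤n)) (ℚₚ.<-≤-trans (0<recip 1) (½≤logSum2 n))
  0<N : 0ℚ ℚ.< ι (2 ℕ.^ m)
  0<N = ι-mono-< {0} (ℕₚ.m^n>0 2 m)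
  I≡ : I ≡ 2 ^- m
  I≡ = *-cancel-inverse {ι (2 ℕ.^ m)} (trans (ℚₚ.*-comm (ι (2 ℕ.^ m)) I) (invℚ-*ˡ 0<N)) (2^*2^- m)

b≤∣p∣ : ∀ {p b} → p ℚ.≤ ℚ.- b → b ℚ.≤ ℚ.∣ p ∣
b≤∣p∣ {p} {b} p≤-b = begin
  b                 ≡⟨ S.solve 1 (λ b → b S.:= S.:- (S.:- b)) refl b ⟩
  ℚ.- (ℚ.- b)       ≤⟨ ℚₚ.neg-antimono-≤ p≤-b ⟩
  ℚ.- p             ≤⟨ p≤∣p∣ (ℚ.- p) ⟩
  ℚ.∣ ℚ.- p ∣       ≡⟨ ℚₚ.∣-p∣≡∣p∣ p ⟩
  ℚ.∣ p ∣           ∎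
  where open ℚₚ.≤-Reasoning

∣p-p∣<ε : ∀ p {ε} → 0ℚ ℚ.< ε → ℚ.∣ p ℚ.- p ∣ ℚ.< ε
∣p-p∣<ε p {ε} = subst (ℚ._< ε) (sym (cong ℚ.∣_∣ (ℚₚ.+-inverseʳ p)))

smallΔ⇒Δ≤ : ∀ m (x : Fin (2 ℕ.^ m) → Point 2) → SmallΔ {{^-nonZero 2 m}} x (γ m) (bound m) →
  let instance N≢0 = ^-nonZero 2 m in
  Σ[ in? ∈ (∀ n → Dec (x n ∈[0, γ m ⟩)) ]
    normalizedΔ (γ m) x in? ≤ fromℚ (ℚ.- ((+ 1 / 4) ℚ.* 2 ^- (m ℕ.+ 2) ℚ.* (+ m / 1)))
smallΔ⇒Δ≤ m x (in? , Δ≤) = in? , seq≤⇒≤ {_} {_} Δ≤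

-- γ lies in the unit square, so the absolute value of its normalized Δ is among the values of which
-- D is an upper bound; `log-bound` is compared with it index by index.
smallΔ⇒D*≥ : ∀ m (x : Fin (2 ℕ.^ m) → Point 2) → SmallΔ {{^-nonZero 2 m}} x (γ m) (bound m) →
  (∀ i → 0ℝ ≤ γ m i × γ m i < 1ℝ) →
  let N = 2 ℕ.^ m
      instance N≢0 = ^-nonZero 2 m
  in
  ∀ D → IsStarDiscrepancy x D →
    (1ℝ ÷ fromℕ 16 * log 2 ⟨ 0<16*log2 ⟩) * (log N ÷ fromℕ N ⟨ 0<fromℕ N ⟩) ≤ D
smallΔ⇒D*≥ m x (in? , Δ≤) γ∈ D (isUpper , _) = seq≤-≤-trans {_} {r} {D}
  (λ n → ℚₚ.≤-trans (log-bound m n) (b≤∣p∣ {seq (normalizedΔ {{^-nonZero 2 m}} (γ m) x in?) n} {bound m} (Δ≤ n)))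
  (isUpper r (γ m , γ∈ , in? , λ ε 0<ε → 0 , λ n _ → ∣p-p∣<ε (seq r n) 0<ε))
  where
  r = ∣ normalizedΔ {{^-nonZero 2 m}} (γ m) x in? ∣

theorem3 : (m : ℕ) → 4 ℕ.≤ m → 4 ∣ m →
    (x : Fin (2 ℕ.^ m) → Point 2) → IsNet 0 m 2 2 x →
    (∀ i → x (first m) i ≃ γ m i) →
    let N = 2 ℕ.^ m
        instance N≢0 = ^-nonZero 2 m
    in
    (Σ[ in? ∈ (∀ n → Dec (x n ∈[0, γ m ⟩)) ]
       normalizedΔ (γ m) x in? ≤ fromℚ (ℚ.- ((+ 1 / 4) ℚ.* 2 ^- (m ℕ.+ 2) ℚ.* (+ m / 1))))
    ×
    (∀ D → IsStarDiscrepancy x D →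
       (1ℝ ÷ fromℕ 16 * log 2 ⟨ 0<16*log2 ⟩) * (log N ÷ fromℕ N ⟨ 0<fromℕ N ⟩) ≤ D)
theorem3 m _ (divides k refl) x net x₀≃γ = smallΔ⇒Δ≤ m x smallΔ , smallΔ⇒D*≥ m x smallΔ (γ∈unitSquare k)
  where
  smallΔ : SmallΔ {{^-nonZero 2 m}} x (γ m) (bound m)
  smallΔ = γ-smallΔ k {x} net x₀≃γ
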